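{- Let $PD(n)$ denote the number of partitions of $n$ with designated summands. Then $$\sum_{n=0}^{\infty} PD(3n+1)q^n = \frac{(q^3;q^6)_\infty^3 (q^6;q^6)_\infty^6}{(q;q^2)_\infty^5 (q^2;q^2)_\infty^8}\left(4q\,\frac{(q;q^2)_\infty^2}{(q^3;q^6)_\infty^6} + \frac{(q^3;q^6)_\infty^3}{(q;q^2)_\infty}\right).$$
   Context: A partition of $n$ with designated summands is an ordinary partition of $n$ in which, for each part size that occurs, exactly one of the parts of that size is designated; if a size $t$ occurs $m_t$ times, the copies are regarded as ordered and the designation may be placed on any one of the $m_t$ positions, different positions giving different objects (e.g. $2'+2$ and $2+2'$ are distinct). $PD(n)$ is the number of such objects, $PD(0)=1$. Notation: $(a;q)_\infty=\prod_{n\ge1}(1-aq^{n-1})$; identities are of formal power series in $q$ (equivalently for $|q|<1$). -}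

module Defs where

open import Data.Nat using (ℕ; zero; suc; _∸_; _≤ᵇ_) renaming (_+_ to _+ℕ_; _*_ to _*ℕ_)
open import Data.Integer using (ℤ; +_; _+_; _*_; -_)
open import Data.Bool using (if_then_else_)
open import Data.List using (List; []; _∷_)

-- Partitions with designated summands.
-- A partition of n into parts ≤ k is determined by the multiplicities
-- m_1,…,m_k (Σ t·m_t = n).  For each size t that occurs (m_t ≥ 1) one of
-- its m_t ordered copies is designated: m_t choices.  Hence the number of
-- designated-summand partitions with parts ≤ k is obtained by choosing the
-- multiplicity m of the largest allowed size k and its designated position.
--   PDb k n = #{partitions of n with designated summands, all parts ≤ k}

sumℕ : ℕ → (ℕ → ℕ) → ℕ
sumℕ zero    g = g zero
sumℕ (suc n) g = sumℕ n g +ℕ g (suc n)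

PDb : ℕ → ℕ → ℕ
PDb zero zero    = 1
PDb zero (suc n) = 0
PDb (suc k) n =
  -- m = 0 copies of part (suc k), or m ≥ 1 copies with m designation choices
  PDb k n +ℕ sumℕ n (λ m → if (1 ≤ᵇ m) Data.Bool.∧ (m *ℕ suc k ≤ᵇ n)
                             then m *ℕ PDb k (n ∸ m *ℕ suc k) else 0)

-- PD(n): parts of a partition of n are at most n.
PD : ℕ → ℕ
PD n = PDb n n

PS : Set
PS = ℕ → ℤ

sumℤ : ℕ → (ℕ → ℤ) → ℤ
sumℤ zero    g = g zero
sumℤ (suc n) g = sumℤ n g + g (suc n)

onePS : PS
onePS zero    = + 1
onePS (suc n) = + 0

_⊛_ : PS → PS → PS
(f ⊛ g) n = sumℤ n (λ i → f i * g (n ∸ i))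

infixl 7 _⊛_

_⊕_ : PS → PS → PS
(f ⊕ g) n = f n + g n

infixl 6 _⊕_

_·_ : ℤ → PS → PS
(c · f) n = c * f n

qShift : PS → PS
qShift f zero    = + 0
qShift f (suc n) = f n

_^PS_ : PS → ℕ → PS
f ^PS zero  = onePS
f ^PS suc k = f ⊛ (f ^PS k)

oneMinusMono : ℕ → PS
oneMinusMono e n =
  (if n Data.Nat.≡ᵇ 0 then + 1 else + 0) + (if n Data.Nat.≡ᵇ e then - + 1 else + 0)

finPoch : ℕ → ℕ → ℕ → PS
finPoch a d zero    = onePS
finPoch a d (suc N) = finPoch a d N ⊛ oneMinusMono (a +ℕ d *ℕ N)

-- (q^a ; q^d)_∞ for a ≥ 1, d ≥ 1: the coefficient of q^n is that of the
-- finite product over m = 0..n, since every factor with m ≥ n+1 has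
-- exponent a + d m > n and does not affect coefficients up to q^n.
poch : ℕ → ℕ → PS
poch a d n = finPoch a d (suc n) n

-- Multiplicative inverse of a power series f with f 0 = 1:
--   c 0 = 1,  c (n+1) = - Σ_{i=1}^{n+1} f i · c (n+1-i).
-- invList f n = [c n, c (n-1), …, c 0].
private
  dot : PS → List ℤ → ℕ → ℤ
  dot f []       k = + 0
  dot f (x ∷ xs) k = f k * x + dot f xs (suc k)

invList : PS → ℕ → List ℤ
invList f zero    = + 1 ∷ []
invList f (suc n) = let L = invList f n in (- dot f L 1) ∷ L

invPS : PS → PS
invPS f n with invList f n
... | []    = + 0
... | c ∷ _ = c

{-# OPTIONS --safe #-}
module Submission where

-- Since 1 + w/(1 - w)² = (1 - w⁶)/((1 - w)(1 - w²)(1 - w³)), the series P of PD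
-- satisfies P f₁ f₂ f₃ = f₆, where f_k = (q^k; q^k)_∞.  The series f₁ f₂ is the product
-- φ(-q) ψ(q) of theta series; by the Jacobi triple product both are sums of monomials,
-- so their 3-sections are again theta series, hence products.  Extracting the exponents
-- 1 mod 3 from P f₁ f₂ f₃ = f₆ is a 3 × 3 linear system whose determinant is the norm
-- F(q) F(ωq) F(ω²q) of F = f₁ f₂ (up to q³ ↦ q).  The norm is multiplicative and is
-- computed factor by factor: it fixes 1 - q^n for 3 ∤ n and sends 1 - q^(3n) to (1 - q^n)³.

-- In P f₁ f₂ f₃ = f₆ the factor f₃ and the right side are series in q³, so only f₁ f₂ has to be
-- trisected. The cofactor that solves for the section of exponents 1 mod 3 is q c² - a b, where a,
-- b, c are the sections of f₁ f₂. With A, -2 B the parts of φ(-q) and C, D those of ψ(q), these are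
-- a = A C, b = A D - 2 B C, c = -2 B D. The products A D and B C are equal, so b collapses to -A D
-- and the cofactor has exactly two product terms: they are the two terms of the theorem, and its 4
-- is (-2)². Three restrictions shape the proof. There is no cube root of unity over ℤ, so the norm
-- is a polynomial in the sections and its multiplicativity a polynomial identity. Quotients are
-- avoided by clearing denominators and cancelling series of constant term 1. Infinite products and
-- theta series are limits of finite ones with a prescribed precision, so the triple product is
-- first proved as an identity of finite products and sums, with Gaussian binomials multiplied by
-- (w; w)_n to stay free of division.

open import Defs
open import Data.Nat using (ℕ; _+_; _*_)
open import Data.Integer using (+_)
open import Relation.Binary.PropositionalEquality using (_≡_)

open import Algebra.Bundles using (CommutativeRing; RawRing)
open import Algebra.Properties.CommutativeSemigroup using (interchange)
import Algebra.Solver.Ring as RingSolver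
open import Algebra.Solver.Ring.AlmostCommutativeRing using (fromCommutativeRing; _-Raw-AlmostCommutative⟶_)
open import Algebra.Structures using (IsCommutativeRing)
open import Data.Bool using (true; false; if_then_else_; _∧_)
open import Data.Integer as ℤ using (ℤ; -1ℤ)
import Data.Integer.Properties as ℤ
import Data.Integer.Tactic.RingSolver as ℤ-RingSolver
open import Data.List using ([]; _∷_)
open import Data.Maybe using (Maybe; just; nothing)
open import Data.Nat as ℕ using (zero; suc; _∸_; _≤_; _<_; _≤ᵇ_; z≤n; s≤s)
import Data.Nat.Properties as ℕ
open import Data.Nat.Tactic.RingSolver using (solve-∀)
open import Data.Product using (_,_; _×_; proj₁; proj₂)
open import Level using (0ℓ)
open import Relation.Binary.PropositionalEquality using (refl; sym; trans; cong; cong₂; subst; module ≡-Reasoning)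
import Relation.Binary.Reasoning.Setoid as SetoidReasoning
open import Relation.Nullary using (yes; no)

-- The ring of power series

sumℤ-cong : ∀ n {f g : ℕ → ℤ} → (∀ {i} → i ≤ n → f i ≡ g i) → sumℤ n f ≡ sumℤ n g
sumℤ-cong zero    h = h z≤n
sumℤ-cong (suc n) h = cong₂ ℤ._+_ (sumℤ-cong n (λ i≤n → h (ℕ.m≤n⇒m≤1+n i≤n))) (h ℕ.≤-refl)

sumℤ-suc : ∀ n (f : ℕ → ℤ) → sumℤ (suc n) f ≡ f 0 ℤ.+ sumℤ n (λ i → f (suc i))
sumℤ-suc zero    f = refl
sumℤ-suc (suc n) f = trans (cong (ℤ._+ f (suc (suc n))) (sumℤ-suc n f)) (ℤ.+-assoc (f 0) _ _)

sumℤ-+ : ∀ n (f g : ℕ → ℤ) → sumℤ n (λ i → f i ℤ.+ g i) ≡ sumℤ n f ℤ.+ sumℤ n g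
sumℤ-+ zero    f g = refl
sumℤ-+ (suc n) f g = trans (cong (ℤ._+ (f (suc n) ℤ.+ g (suc n))) (sumℤ-+ n f g))
  (interchange ℤ.+-commutativeSemigroup (sumℤ n f) (sumℤ n g) (f (suc n)) (g (suc n)))

sumℤ-* : ∀ n c (f : ℕ → ℤ) → sumℤ n (λ i → c ℤ.* f i) ≡ c ℤ.* sumℤ n f
sumℤ-* zero    c f = refl
sumℤ-* (suc n) c f = trans (cong (ℤ._+ c ℤ.* f (suc n)) (sumℤ-* n c f)) (sym (ℤ.*-distribˡ-+ c _ _))

sumℤ-0 : ∀ n → sumℤ n (λ _ → + 0) ≡ + 0
sumℤ-0 zero    = refl
sumℤ-0 (suc n) = trans (ℤ.+-identityʳ _) (sumℤ-0 n)

infix 4 _≈_ _≈[_]_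

record _≈_ (f g : PS) : Set where
  constructor mk≈
  field at : ∀ n → f n ≡ g n
open _≈_ public

-- Congruence modulo q^N; limits of series are expressed through it.
record _≈[_]_ (f : PS) (N : ℕ) (g : PS) : Set where
  constructor mk≈[]
  field below : ∀ {n} → n < N → f n ≡ g n
open _≈[_]_ public

tail : PS → PS
tail f n = f (suc n)

K : ℤ → PS
K c zero    = c
K c (suc n) = + 0

⊛-at-cong : ∀ n {f f′ g g′ : PS} → (∀ {i} → i ≤ n → f i ≡ f′ i) → (∀ {i} → i ≤ n → g i ≡ g′ i) →
            (f ⊛ g) n ≡ (f′ ⊛ g′) n
⊛-at-cong n p q = sumℤ-cong n (λ {i} i≤n → cong₂ ℤ._*_ (p i≤n) (q (ℕ.m∸n≤m n i)))

⊛-suc : ∀ f g n → (f ⊛ g) (suc n) ≡ f 0 ℤ.* g (suc n) ℤ.+ (tail f ⊛ g) n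
⊛-suc f g n = sumℤ-suc n _

⊛-suc′ : ∀ f g n → (f ⊛ g) (suc n) ≡ (f ⊛ tail g) n ℤ.+ f (suc n) ℤ.* g 0
⊛-suc′ f g n = cong₂ ℤ._+_
  (sumℤ-cong n (λ {i} i≤n → cong (λ m → f i ℤ.* g m) (ℕ.+-∸-assoc 1 i≤n)))
  (cong (λ m → f (suc n) ℤ.* g m) (ℕ.n∸n≡0 n))

-- Splitting off the first term of one convolution and the last term of the other leaves two shorter
-- convolutions that the induction compares; hence the induction varies `f`.
⊛-comm : ∀ f g → f ⊛ g ≈ g ⊛ f
⊛-comm f g = mk≈ (go f g)
  where
  go : ∀ f g n → (f ⊛ g) n ≡ (g ⊛ f) n
  go f g zero    = ℤ.*-comm (f 0) (g 0)
  go f g (suc n) = begin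
    (f ⊛ g) (suc n)                       ≡⟨ ⊛-suc f g n ⟩
    f 0 ℤ.* g (suc n) ℤ.+ (tail f ⊛ g) n      ≡⟨ cong₂ ℤ._+_ (ℤ.*-comm (f 0) _) (go (tail f) g n) ⟩
    g (suc n) ℤ.* f 0 ℤ.+ (g ⊛ tail f) n      ≡⟨ ℤ.+-comm (g (suc n) ℤ.* f 0) _ ⟩
    (g ⊛ tail f) n ℤ.+ g (suc n) ℤ.* f 0      ≡⟨ ⊛-suc′ g f n ⟨
    (g ⊛ f) (suc n)                       ∎
    where open ≡-Reasoning

⊛-distribʳ : ∀ h f g → (f ⊕ g) ⊛ h ≈ f ⊛ h ⊕ g ⊛ h
⊛-distribʳ h f g = mk≈ λ n →
  trans (sumℤ-cong n (λ {i} _ → ℤ.*-distribʳ-+ (h (n ∸ i)) (f i) (g i))) (sumℤ-+ n _ _)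

·-⊛-assoc : ∀ c f g → (c · f) ⊛ g ≈ c · (f ⊛ g)
·-⊛-assoc c f g = mk≈ λ n →
  trans (sumℤ-cong n (λ {i} _ → ℤ.*-assoc c (f i) (g (n ∸ i)))) (sumℤ-* n c _)

-- With f = f 0 + q (tail f), the constant part is associativity in ℤ and distributivity; the rest
-- is the same claim for `tail f`, one degree lower.
⊛-assoc : ∀ f g h → (f ⊛ g) ⊛ h ≈ f ⊛ (g ⊛ h)
⊛-assoc f g h = mk≈ (go f)
  where
  open ≡-Reasoning
  go : ∀ f n → ((f ⊛ g) ⊛ h) n ≡ (f ⊛ (g ⊛ h)) n
  go f zero    = ℤ.*-assoc (f 0) (g 0) (h 0)
  go f (suc n) = begin
    ((f ⊛ g) ⊛ h) (suc n)
      ≡⟨ ⊛-suc (f ⊛ g) h n ⟩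
    f 0 ℤ.* g 0 ℤ.* h (suc n) ℤ.+ (tail (f ⊛ g) ⊛ h) n
      ≡⟨ cong (λ u → f 0 ℤ.* g 0 ℤ.* h (suc n) ℤ.+ u) (⊛-at-cong n {g = h} (λ {i} _ → ⊛-suc f g i) (λ _ → refl)) ⟩
    f 0 ℤ.* g 0 ℤ.* h (suc n) ℤ.+ (((f 0 · tail g) ⊕ tail f ⊛ g) ⊛ h) n
      ≡⟨ cong (λ u → f 0 ℤ.* g 0 ℤ.* h (suc n) ℤ.+ u) (at (⊛-distribʳ h (f 0 · tail g) (tail f ⊛ g)) n) ⟩
    f 0 ℤ.* g 0 ℤ.* h (suc n) ℤ.+ (((f 0 · tail g) ⊛ h) n ℤ.+ ((tail f ⊛ g) ⊛ h) n)
      ≡⟨ cong₂ (λ u v → f 0 ℤ.* g 0 ℤ.* h (suc n) ℤ.+ (u ℤ.+ v)) (at (·-⊛-assoc (f 0) (tail g) h) n) (go (tail f) n) ⟩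
    f 0 ℤ.* g 0 ℤ.* h (suc n) ℤ.+ (f 0 ℤ.* (tail g ⊛ h) n ℤ.+ (tail f ⊛ (g ⊛ h)) n)
      ≡⟨ ℤ.+-assoc (f 0 ℤ.* g 0 ℤ.* h (suc n)) _ _ ⟨
    f 0 ℤ.* g 0 ℤ.* h (suc n) ℤ.+ f 0 ℤ.* (tail g ⊛ h) n ℤ.+ (tail f ⊛ (g ⊛ h)) n
      ≡⟨ cong (λ u → u ℤ.+ f 0 ℤ.* (tail g ⊛ h) n ℤ.+ (tail f ⊛ (g ⊛ h)) n) (ℤ.*-assoc (f 0) (g 0) _) ⟩
    f 0 ℤ.* (g 0 ℤ.* h (suc n)) ℤ.+ f 0 ℤ.* (tail g ⊛ h) n ℤ.+ (tail f ⊛ (g ⊛ h)) n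
      ≡⟨ cong (ℤ._+ (tail f ⊛ (g ⊛ h)) n) (ℤ.*-distribˡ-+ (f 0) _ _) ⟨
    f 0 ℤ.* (g 0 ℤ.* h (suc n) ℤ.+ (tail g ⊛ h) n) ℤ.+ (tail f ⊛ (g ⊛ h)) n
      ≡⟨ cong (λ u → f 0 ℤ.* u ℤ.+ (tail f ⊛ (g ⊛ h)) n) (⊛-suc g h n) ⟨
    f 0 ℤ.* (g ⊛ h) (suc n) ℤ.+ (tail f ⊛ (g ⊛ h)) n
      ≡⟨ ⊛-suc f (g ⊛ h) n ⟨
    (f ⊛ (g ⊛ h)) (suc n) ∎

K-⊛ : ∀ c f → K c ⊛ f ≈ c · f
K-⊛ c f = mk≈ go
  where
  go : ∀ n → (K c ⊛ f) n ≡ c ℤ.* f n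
  go zero    = refl
  go (suc n) = trans (⊛-suc (K c) f n)
    (trans (cong (λ u → c ℤ.* f (suc n) ℤ.+ u) (trans (sumℤ-cong n (λ {i} _ → ℤ.*-zeroˡ (f (n ∸ i)))) (sumℤ-0 n)))
           (ℤ.+-identityʳ _))

K-0 : ∀ n → K (+ 0) n ≡ + 0
K-0 zero    = refl
K-0 (suc n) = refl

K-1-⊛ : ∀ f → K (+ 1) ⊛ f ≈ f
K-1-⊛ f = mk≈ λ n → trans (at (K-⊛ (+ 1) f) n) (ℤ.*-identityˡ (f n))

K-1 : K (+ 1) ≈ onePS
K-1 = mk≈ λ { zero → refl ; (suc n) → refl }

infixl 7 _∙_
infixl 6 _⊞_
infix  8 ⊟_

-- Left transparent, ⊛ and ⊕ unfold to sums under η and block the inference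
-- of their arguments.
opaque
  _∙_ _⊞_ : PS → PS → PS
  _∙_ = _⊛_
  _⊞_ = _⊕_

  ⊟_ : PS → PS
  (⊟ f) n = ℤ.- f n

  PS-isCommutativeRing : IsCommutativeRing _≈_ _⊞_ _∙_ ⊟_ (K (+ 0)) (K (+ 1))
  PS-isCommutativeRing = record
    { isRing = record
      { +-isAbelianGroup = record
        { isGroup = record
          { isMonoid = record
            { isSemigroup = record
              { isMagma = record
                { isEquivalence = record
                  { refl  = mk≈ λ _ → refl
                  ; sym   = λ p → mk≈ λ n → sym (at p n)
                  ; trans = λ p r → mk≈ λ n → trans (at p n) (at r n)
                  }
                ; ∙-cong = λ p r → mk≈ λ n → cong₂ ℤ._+_ (at p n) (at r n)
                }
              ; assoc = λ f g h → mk≈ λ n → ℤ.+-assoc (f n) (g n) (h n)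
              }
            ; identity = (λ f → mk≈ λ n → trans (cong (ℤ._+ f n) (K-0 n)) (ℤ.+-identityˡ (f n)))
                       , (λ f → mk≈ λ n → trans (cong (λ c → f n ℤ.+ c) (K-0 n)) (ℤ.+-identityʳ (f n)))
            }
          ; inverse = (λ f → mk≈ λ n → trans (ℤ.+-inverseˡ (f n)) (sym (K-0 n)))
                    , (λ f → mk≈ λ n → trans (ℤ.+-inverseʳ (f n)) (sym (K-0 n)))
          ; ⁻¹-cong = λ p → mk≈ λ n → cong ℤ.-_ (at p n)
          }
        ; comm = λ f g → mk≈ λ n → ℤ.+-comm (f n) (g n)
        }
      ; *-cong = λ p r → mk≈ λ n → ⊛-at-cong n (λ {i} _ → at p i) (λ {i} _ → at r i)
      ; *-assoc = ⊛-assoc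
      ; *-identity = K-1-⊛ , λ f → mk≈ λ n → trans (at (⊛-comm f (K (+ 1))) n) (at (K-1-⊛ f) n)
      ; distrib = (λ h f g → mk≈ λ n → trans (at (⊛-comm h (f ⊕ g)) n)
                    (trans (at (⊛-distribʳ h f g) n) (cong₂ ℤ._+_ (at (⊛-comm f h) n) (at (⊛-comm g h) n))))
                , ⊛-distribʳ
      }
    ; *-comm = ⊛-comm
    }

PS-commutativeRing : CommutativeRing 0ℓ 0ℓ
PS-commutativeRing = record { isCommutativeRing = PS-isCommutativeRing }

open CommutativeRing PS-commutativeRing public
  using (setoid)
  renaming ( refl to ≈-refl; reflexive to ≈-reflexive; sym to ≈-sym; trans to ≈-trans; +-cong to ⊞-cong; +-congˡ to ⊞-congˡ; +-congʳ to ⊞-congʳ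
           ; *-cong to ∙-cong; *-congˡ to ∙-congˡ; *-congʳ to ∙-congʳ; -‿cong to ⊟-cong; *-identityˡ to K-1-∙)

ℤ-rawRing : RawRing 0ℓ 0ℓ
ℤ-rawRing = CommutativeRing.rawRing ℤ.+-*-commutativeRing

opaque
  unfolding _∙_

  K-+ : ∀ a b → K (a ℤ.+ b) ≈ K a ⊞ K b
  K-+ a b = mk≈ λ { zero → refl ; (suc n) → refl }

  K-* : ∀ a b → K (a ℤ.* b) ≈ K a ∙ K b
  K-* a b = mk≈ λ { zero → refl ; (suc n) → sym (trans (at (K-⊛ a (K b)) (suc n)) (ℤ.*-zeroʳ a)) }

  K-neg : ∀ a → K (ℤ.- a) ≈ ⊟ K a
  K-neg a = mk≈ λ { zero → refl ; (suc n) → refl }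

  ∙≈⊛ : ∀ f g → f ∙ g ≈ f ⊛ g
  ∙≈⊛ f g = ≈-refl

  ⊞-at : ∀ f g n → (f ⊞ g) n ≡ f n ℤ.+ g n
  ⊞-at f g n = refl

  ⊟-at : ∀ f n → (⊟ f) n ≡ ℤ.- f n
  ⊟-at f n = refl

K-homomorphism : ℤ-rawRing -Raw-AlmostCommutative⟶ fromCommutativeRing PS-commutativeRing
K-homomorphism = record
  { ⟦_⟧    = K
  ; +-homo = K-+
  ; *-homo = K-*
  ; -‿homo = K-neg
  ; 0-homo = ≈-refl
  ; 1-homo = ≈-refl
  }

K-≟ : ∀ a b → Maybe (K a ≈ K b)
K-≟ a b with a ℤ.≟ b
... | yes refl = just ≈-refl
... | no _     = nothing

open RingSolver ℤ-rawRing (fromCommutativeRing PS-commutativeRing) K-homomorphism K-≟ public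
  using (Polynomial; solve; _:=_; _:*_; _:+_; :-_; con; _:^_)

-- Inverses, monomials and truncation

-- The function dot of Defs is private: its name is recovered by unification, and
-- abstracting over 1 is what makes the unification problem a pattern.
mutual
  invPS-suc : ∀ f n (c : ℕ → ℤ) → (∀ k → ((λ i → f (k ℕ.+ i)) ⊛ invPS f) n ≡ c k) →
              invPS f (suc n) ≡ ℤ.- c 1
  invPS-suc f n c shifted≡c with 1
  ... | k = cong ℤ.-_ (trans (dot-invList f n k) (shifted≡c k))

  dot-invList : ∀ f n k → _ ≡ ((λ i → f (k ℕ.+ i)) ⊛ invPS f) n
  dot-invList f zero    k = trans (ℤ.+-identityʳ _) (cong (λ m → f m ℤ.* + 1) (sym (ℕ.+-identityʳ k)))
  dot-invList f (suc n) k = trans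
    (cong₂ ℤ._+_ (cong (λ m → f m ℤ.* invPS f (suc n)) (sym (ℕ.+-identityʳ k)))
      (trans (dot-invList f n (suc k)) (⊛-at-cong n {g = invPS f} (λ {i} _ → cong f (sym
          (ℕ.+-suc k i))) (λ _ → refl))))
    (sym (⊛-suc (λ i → f (k ℕ.+ i)) (invPS f) n))

⊛-invPS : ∀ f → f 0 ≡ + 1 → f ⊛ invPS f ≈ K (+ 1)
⊛-invPS f f₀≡1 = mk≈ go
  where
  open ≡-Reasoning
  r : PS
  r = tail f ⊛ invPS f
  go : ∀ n → (f ⊛ invPS f) n ≡ K (+ 1) n
  go zero    = trans (ℤ.*-identityʳ (f 0)) f₀≡1
  go (suc n) = begin
    (f ⊛ invPS f) (suc n)          ≡⟨ ⊛-suc f (invPS f) n ⟩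
    f 0 ℤ.* invPS f (suc n) ℤ.+ r n    ≡⟨ cong₂ (λ a b → a ℤ.* b ℤ.+ r n) f₀≡1 (invPS-suc f n _ (λ _ → refl)) ⟩
    + 1 ℤ.* ℤ.- r n ℤ.+ r n              ≡⟨ cong (ℤ._+ r n) (ℤ.*-identityˡ (ℤ.- r n)) ⟩
    ℤ.- r n ℤ.+ r n                    ≡⟨ ℤ.+-inverseˡ (r n) ⟩
    + 0                            ∎

∙-invPS : ∀ f → f 0 ≡ + 1 → f ∙ invPS f ≈ K (+ 1)
∙-invPS f f₀≡1 = ≈-trans (∙≈⊛ f (invPS f)) (⊛-invPS f f₀≡1)

∙-cancelˡ : ∀ {f g h} → f 0 ≡ + 1 → f ∙ g ≈ f ∙ h → g ≈ h
∙-cancelˡ {f} {g} {h} f₀≡1 fg≈fh = ≈-trans (expand g) (≈-trans (∙-congˡ fg≈fh) (≈-sym (expand h)))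
  where
  expand : ∀ g → g ≈ invPS f ∙ (f ∙ g)
  expand g = ≈-trans (≈-sym (K-1-∙ g)) (≈-trans (∙-congʳ (≈-sym (∙-invPS f f₀≡1)))
    (solve 3 (λ f i g → f :* i :* g := i :* (f :* g)) ≈-refl f (invPS f) g))

∙-suc : ∀ f g n → (f ∙ g) (suc n) ≡ f 0 ℤ.* g (suc n) ℤ.+ (tail f ∙ g) n
∙-suc f g n = trans (at (∙≈⊛ f g) (suc n)) (trans (⊛-suc f g n)
  (cong (λ c → f 0 ℤ.* g (suc n) ℤ.+ c) (sym (at (∙≈⊛ (tail f) g) n))))

∙-zero : ∀ f g → (f ∙ g) 0 ≡ f 0 ℤ.* g 0
∙-zero f g = at (∙≈⊛ f g) 0

qShift-∙ : ∀ f g → qShift f ∙ g ≈ qShift (f ∙ g)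
qShift-∙ f g = mk≈ go
  where
  go : ∀ n → (qShift f ∙ g) n ≡ qShift (f ∙ g) n
  go zero    = ∙-zero (qShift f) g
  go (suc n) = trans (∙-suc (qShift f) g n) (ℤ.+-identityˡ _)

mono : ℕ → PS
mono zero    = K (+ 1)
mono (suc e) = qShift (mono e)

q : PS
q = mono 1

qShift-cong : ∀ {f g} → f ≈ g → qShift f ≈ qShift g
qShift-cong f≈g = mk≈ λ { zero → refl ; (suc n) → at f≈g n }

q-∙ : ∀ f → q ∙ f ≈ qShift f
q-∙ f = ≈-trans (qShift-∙ (K (+ 1)) f) (qShift-cong (K-1-∙ f))

mono-+ : ∀ a b → mono (a ℕ.+ b) ≈ mono a ∙ mono b
mono-+ zero    b = ≈-sym (K-1-∙ (mono b))
mono-+ (suc a) b = ≈-trans (qShift-cong (mono-+ a b)) (≈-sym (qShift-∙ (mono a) (mono b)))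

mono-cong : ∀ {a b} → a ≡ b → mono a ≈ mono b
mono-cong refl = ≈-refl

oneMinusMono-≈ : ∀ e → oneMinusMono e ≈ K (+ 1) ⊞ ⊟ mono e
oneMinusMono-≈ e = mk≈ λ n → sym (trans (⊞-at (K (+ 1)) (⊟ mono e) n)
  (cong₂ ℤ._+_ (unit n) (trans (⊟-at (mono e) n) (coeff e n))))
  where
  open import Data.Bool using (if_then_else_)
  unit : ∀ n → K (+ 1) n ≡ (if n ℕ.≡ᵇ 0 then ℤ.+ 1 else ℤ.+ 0)
  unit zero    = refl
  unit (suc n) = refl
  coeff : ∀ e n → ℤ.- mono e n ≡ (if n ℕ.≡ᵇ e then ℤ.- + 1 else ℤ.+ 0)
  coeff zero    zero    = refl
  coeff zero    (suc n) = refl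
  coeff (suc e) zero    = refl
  coeff (suc e) (suc n) = coeff e n

≈⇒≈[] : ∀ {f g N} → f ≈ g → f ≈[ N ] g
≈⇒≈[] p = mk≈[] λ {n} _ → at p n

≈[]-refl : ∀ {f N} → f ≈[ N ] f
≈[]-refl = mk≈[] λ _ → refl

≈[]-sym : ∀ {f g N} → f ≈[ N ] g → g ≈[ N ] f
≈[]-sym p = mk≈[] λ n<N → sym (below p n<N)

≈[]-trans : ∀ {f g h N} → f ≈[ N ] g → g ≈[ N ] h → f ≈[ N ] h
≈[]-trans p r = mk≈[] λ n<N → trans (below p n<N) (below r n<N)

≈[]-mono : ∀ {f g M N} → M ≤ N → f ≈[ N ] g → f ≈[ M ] g
≈[]-mono M≤N p = mk≈[] λ n<M → below p (ℕ.<-≤-trans n<M M≤N)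

opaque
  unfolding _∙_

  ⊞-cong[] : ∀ {f f′ g g′ N} → f ≈[ N ] f′ → g ≈[ N ] g′ → f ⊞ g ≈[ N ] f′ ⊞ g′
  ⊞-cong[] p r = mk≈[] λ n<N → cong₂ ℤ._+_ (below p n<N) (below r n<N)

  ⊟-cong[] : ∀ {f f′ N} → f ≈[ N ] f′ → ⊟ f ≈[ N ] ⊟ f′
  ⊟-cong[] p = mk≈[] λ n<N → cong ℤ.-_ (below p n<N)

  ∙-cong[] : ∀ {f f′ g g′ N} → f ≈[ N ] f′ → g ≈[ N ] g′ → f ∙ g ≈[ N ] f′ ∙ g′
  ∙-cong[] p r = mk≈[] λ {n} n<N →
    ⊛-at-cong n (λ i≤n → below p (ℕ.≤-<-trans i≤n n<N)) (λ i≤n → below r (ℕ.≤-<-trans i≤n n<N))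

qShift-cong[] : ∀ {f g N} → f ≈[ N ] g → qShift f ≈[ suc N ] qShift g
qShift-cong[] p = mk≈[] λ { {zero} _ → refl ; {suc n} (s≤s n<N) → below p n<N }

mono-∙-cong[] : ∀ e {f g N} → f ≈[ N ] g → mono e ∙ f ≈[ e ℕ.+ N ] mono e ∙ g
mono-∙-cong[] zero    p = ∙-cong[] ≈[]-refl p
mono-∙-cong[] (suc e) {f} {g} p = ≈[]-trans (≈⇒≈[] (qShift-∙ (mono e) f))
  (≈[]-trans (qShift-cong[] (mono-∙-cong[] e p)) (≈⇒≈[] (≈-sym (qShift-∙ (mono e) g))))

mono-≈[] : ∀ {e N} → N ≤ e → mono e ≈[ N ] K (+ 0)
mono-≈[] {e} N≤e = mk≈[] λ {n} n<N → trans (lt e n (ℕ.<-≤-trans n<N N≤e)) (sym (K-0 n))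
  where
  lt : ∀ e n → n < e → mono e n ≡ + 0
  lt (suc e) zero    _       = refl
  lt (suc e) (suc n) (s≤s p) = lt e n p

open SetoidReasoning setoid

-- The finite Jacobi triple product

infix 9 1-_ 1+_
1-_ 1+_ : PS → PS
1- f = K (+ 1) ⊞ ⊟ f
1+ f = K (+ 1) ⊞ f

∏ : ℕ → (ℕ → PS) → PS
∏ zero    F = K (+ 1)
∏ (suc n) F = ∏ n F ∙ F n

-- Products run over j < n, sums over k ≤ n.
∑ : ℕ → (ℕ → PS) → PS
∑ zero    F = F zero
∑ (suc n) F = ∑ n F ⊞ F (suc n)

infixr 10 _^^_
_^^_ : PS → ℕ → PS
w ^^ zero  = K (+ 1)
w ^^ suc n = w ∙ w ^^ n

^^-+ : ∀ w m n → w ^^ (m + n) ≈ w ^^ m ∙ w ^^ n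
^^-+ w zero    n = ≈-sym (K-1-∙ (w ^^ n))
^^-+ w (suc m) n = ≈-trans (∙-congˡ (^^-+ w m n))
  (solve 3 (λ w a b → w :* (a :* b) := w :* a :* b) ≈-refl w (w ^^ m) (w ^^ n))

^^-cong : ∀ w {m n} → m ≡ n → w ^^ m ≈ w ^^ n
^^-cong w refl = ≈-refl

tri : ℕ → ℕ
tri zero    = 0
tri (suc k) = k + tri k

module FiniteJacobi (s t : PS) where

  w : PS
  w = s ∙ t

  -- Vanishes for k > n, by the factor 1 - w⁰ at i = n.
  fall : ℕ → ℕ → PS
  fall n k = ∏ k (λ i → 1- w ^^ (n ∸ i))

  -- (w; w)_n times the Gaussian binomial coefficient [2n, n + k]_w.
  U : ℕ → ℕ → PS
  U n k = fall n k ∙ fall (n + n) (n ∸ k)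

  fall-suc : ∀ n k → fall (suc n) (suc k) ≈ 1- w ^^ suc n ∙ fall n k
  fall-suc n zero    = solve 1 (λ a → con (+ 1) :* a := a :* con (+ 1)) ≈-refl (1- w ^^ suc n)
  fall-suc n (suc k) = ≈-trans (∙-congʳ (fall-suc n k))
    (solve 3 (λ a b c → a :* b :* c := a :* (b :* c)) ≈-refl (1- w ^^ suc n) (fall n k) (1- w ^^ (n ∸ k)))

  fall-beyond : ∀ n → fall n (suc n) ≈ K (+ 0)
  fall-beyond n = ≈-trans (∙-congˡ (⊞-congˡ (⊟-cong (^^-cong w (ℕ.n∸n≡0 n)))))
    (solve 1 (λ a → a :* (con (+ 1) :+ :- con (+ 1)) := con (+ 0)) ≈-refl (fall n n))

  U-beyond : ∀ n → U n (suc n) ≈ K (+ 0)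
  U-beyond n = ≈-trans (∙-congʳ (fall-beyond n))
    (solve 1 (λ a → con (+ 0) :* a := con (+ 0)) ≈-refl (fall (n + n) (n ∸ suc n)))

  U-diagonal : ∀ n → U (suc n) (suc n) ≈ 1- w ^^ suc n ∙ U n n
  U-diagonal n = begin
    fall (suc n) (suc n) ∙ fall (suc n + suc n) (n ∸ n)
      ≈⟨ ∙-cong (fall-suc n n) (fall-0 (suc n + suc n)) ⟩
    1- w ^^ suc n ∙ fall n n ∙ K (+ 1)
      ≈⟨ solve 2 (λ a b → a :* b :* con (+ 1) := a :* (b :* con (+ 1))) ≈-refl (1- w ^^ suc n) (fall n n) ⟩
    1- w ^^ suc n ∙ (fall n n ∙ K (+ 1))
      ≈⟨ ∙-congˡ (∙-congˡ (fall-0 (n + n))) ⟨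
    1- w ^^ suc n ∙ U n n ∎
    where
    fall-0 : ∀ a → fall a (n ∸ n) ≈ K (+ 1)
    fall-0 a = ≈-reflexive (cong (fall a) (ℕ.n∸n≡0 n))

  U-≡ : ∀ n k {p} → n ∸ k ≡ p → U n k ≈ fall n k ∙ fall (n + n) p
  U-≡ n k refl = ≈-refl

  fall-double : ∀ n p →
      fall (suc n + suc n) (suc (suc p)) ≈ 1- w ^^ suc (suc (n + n)) ∙ (1- w ^^ suc (n + n) ∙ fall (n + n) p)
  fall-double n p = ≈-trans (≈-reflexive (cong (λ m → fall (suc m) (suc (suc p))) (ℕ.+-suc n n)))
    (≈-trans (fall-suc (suc (n + n)) (suc p)) (∙-congˡ (fall-suc (n + n) p)))

  fall-end : ∀ n p {a} → n ∸ p ≡ a → fall n (suc p) ≈ fall n p ∙ 1- w ^^ a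
  fall-end n p refl = ≈-refl

  -- The recurrence is the q-Pascal rule applied twice, once in each of its two forms, to pass from
  -- [2n, .] to [2n + 2, .]; the factor 1 - w^(n+1) updates (w; w)_n. Truncated subtraction forces
  -- the cases k = n, k = n - 1 and k ≤ n - 2. Here two of the three neighbours lie outside the
  -- range and vanish.
  U-step-last : ∀ n → U (suc n) (suc n) ≈
    1- w ^^ suc n ∙ (1+ w ^^ suc (n + n) ∙ U n (suc n) ⊞ w ^^ (n ∸ n) ∙ U n n ⊞ w ^^ (n + suc (suc n)) ∙ U n (suc (suc n)))
  U-step-last n = ≈-trans (U-diagonal n) (∙-congˡ (≈-sym (begin
    1+ w ^^ suc (n + n) ∙ U n (suc n) ⊞ w ^^ (n ∸ n) ∙ U n n ⊞ w ^^ (n + suc (suc n)) ∙ U n (suc (suc n))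
      ≈⟨ ⊞-cong (⊞-cong (∙-congˡ (U-beyond n)) (∙-congʳ (^^-cong w (ℕ.n∸n≡0 n)))) (∙-congˡ (∙-congʳ
          (∙-congʳ (fall-beyond n)))) ⟩
    1+ w ^^ suc (n + n) ∙ K (+ 0) ⊞ K (+ 1) ∙ U n n ⊞ w ^^ (n + suc (suc n)) ∙ (K (+ 0) ∙ f₁ ∙ f₂)
      ≈⟨ solve 5 (λ a b c d e → (con (+ 1) :+ a) :* con (+ 0) :+ con (+ 1) :* b :+ c :* (con (+ 0) :* d :* e) :=
          b) ≈-refl
           (w ^^ suc (n + n)) (U n n) (w ^^ (n + suc (suc n))) f₁ f₂ ⟩
    U n n ∎)))
    where
    f₁ f₂ : PS
    f₁ = 1- w ^^ (n ∸ suc n)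
    f₂ = fall (n + n) (n ∸ suc (suc n))

  U-step-penultimate : ∀ k → U (suc (suc k)) (suc k) ≈
    1- w ^^ suc (suc k) ∙ (1+ w ^^ suc (suc k + suc k) ∙ U (suc k) (suc k)
      ⊞ w ^^ (suc k ∸ k) ∙ U (suc k) k ⊞ w ^^ (suc k + suc (suc k)) ∙ U (suc k) (suc (suc k)))
  U-step-penultimate k = begin
    U (suc n) n
      ≈⟨ U-≡ (suc n) n (trans (ℕ.+-∸-assoc 1 (ℕ.≤-refl {n})) (cong suc (ℕ.n∸n≡0 n))) ⟩
    fall (suc n) n ∙ fall (suc n + suc n) 1
      ≈⟨ ∙-cong (fall-suc n k) (∙-congˡ (⊞-congˡ (⊟-cong (≈-trans (^^-cong w (cong suc (ℕ.+-suc n n))) (∙-congˡ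
          (∙-congˡ 2n)))))) ⟩
    c ∙ F ∙ (K (+ 1) ∙ 1- (w ∙ (w ∙ (w ∙ P))))
      ≈⟨ solve 4 (λ c F w P → c :* F :* (con (+ 1) :* (con (+ 1) :+ :- (w :* (w :* (w :* P))))) :=
                  c :* ((con (+ 1) :+ w :* (w :* P)) :* (F :* (con (+ 1) :+ :- (w :* con (+ 1))) :* con (+ 1))
                     :+ w :* con (+ 1) :* (F :* (con (+ 1) :* (con (+ 1) :+ :- (w :* P))))))
           ≈-refl c F w P ⟩
    c ∙ (1+ (w ∙ (w ∙ P)) ∙ (F ∙ 1- w ^^ 1 ∙ K (+ 1)) ⊞ w ^^ 1 ∙ (F ∙ (K (+ 1) ∙ 1- (w ∙ P))))
      ≈⟨ ∙-congˡ (⊞-cong (∙-cong (⊞-congˡ (≈-sym (∙-congˡ 2n)))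
           (≈-sym (≈-trans (U-≡ n n (ℕ.n∸n≡0 n)) (∙-congʳ (fall-end n k 1≡)))))
           (∙-cong (^^-cong w (sym 1≡)) (≈-sym (≈-trans (U-≡ n k 1≡) (∙-congˡ (∙-congˡ (⊞-congˡ (⊟-cong 2n)))))))) ⟩
    c ∙ (1+ w ^^ suc (n + n) ∙ U n n ⊞ w ^^ (n ∸ k) ∙ U n k)
      ≈⟨ ∙-congˡ (≈-trans (solve 2 (λ a b → a := a :+ b :* con (+ 0))
          ≈-refl _ _) (⊞-congˡ (∙-congˡ (≈-sym (U-beyond n))))) ⟩
    c ∙ (1+ w ^^ suc (n + n) ∙ U n n ⊞ w ^^ (n ∸ k) ∙ U n k ⊞ w ^^ (n + suc n) ∙ U n (suc n)) ∎
    where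
    n : ℕ
    n = suc k
    c F P : PS
    c = 1- w ^^ suc n
    F = fall n k
    P = w ^^ (k + suc k)
    2n : w ^^ (n + n) ≈ w ∙ P
    2n = ≈-refl
    1≡ : suc k ∸ k ≡ 1
    1≡ = trans (ℕ.+-∸-assoc 1 (ℕ.≤-refl {k})) (cong suc (ℕ.n∸n≡0 k))

  -- Every term is a multiple of c A B. What remains is a polynomial identity in w, X = w^r and Z =
  -- w^(n+k+1), once w^(2n) is written as Z w X.
  U-step-inner : ∀ k r → let n = r + suc (suc k) in U (suc n) (suc k) ≈
    1- w ^^ suc n ∙ (1+ w ^^ suc (n + n) ∙ U n (suc k) ⊞ w ^^ (n ∸ k) ∙ U n k ⊞ w ^^ (n + suc (suc k)) ∙ U n (suc (suc k)))
  U-step-inner k r = begin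
    U (suc n) (suc k)
      ≈⟨ U-≡ (suc n) (suc k) k↦ ⟩
    fall (suc n) (suc k) ∙ fall (suc n + suc n) (suc (suc r))
      ≈⟨ ∙-cong (fall-suc n k) (≈-trans (fall-double n r) (∙-cong (⊞-congˡ (⊟-cong (∙-congˡ (∙-congˡ 2n)))) (∙-congʳ
          (⊞-congˡ (⊟-cong (∙-congˡ 2n)))))) ⟩
    c ∙ A ∙ (1- (w ∙ (w ∙ (Z ∙ (w ∙ X)))) ∙ (1- (w ∙ (Z ∙ (w ∙ X))) ∙ B))
      ≈⟨ solve 6 (λ c A B w X Z →
           c :* A :* ((con (+ 1) :+ :- (w :* (w :* (Z :* (w :* X))))) :* ((con (+ 1) :+ :- (w :* (Z :* (w :* X)))) :* B)) :=
           c :* ((con (+ 1) :+ w :* (Z :* (w :* X))) :* (A :* (con (+ 1) :+ :- (w :* (w :* X))) :* (B :* (con (+ 1) :+ :- (w :* Z))))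
              :+ w :* (w :* X) :* (A :* (B :* (con (+ 1) :+ :- (w :* Z)) :* (con (+ 1) :+ :- Z)))
              :+ w :* Z :* (A :* (con (+ 1) :+ :- (w :* (w :* X))) :* (con (+ 1) :+ :- (w :* X)) :* B)))
           ≈-refl c A B w X Z ⟩
    c ∙ (1+ (w ∙ (Z ∙ (w ∙ X))) ∙ (A ∙ 1- (w ∙ (w ∙ X)) ∙ (B ∙ 1- (w ∙ Z)))
       ⊞ w ∙ (w ∙ X) ∙ (A ∙ (B ∙ 1- (w ∙ Z) ∙ 1- Z))
       ⊞ w ∙ Z ∙ (A ∙ 1- (w ∙ (w ∙ X)) ∙ 1- (w ∙ X) ∙ B))
      ≈⟨ ∙-congˡ (⊞-cong (⊞-cong
           (∙-cong (⊞-congˡ (∙-congˡ (≈-sym 2n))) (≈-sym (≈-trans (U-≡ n (suc k) sk↦) (∙-cong A′ B′))))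
           (∙-cong (^^-cong w (sym k↦)) (≈-sym (≈-trans (U-≡ n k k↦) (∙-congˡ
               (≈-trans (fall-end (n + n) (suc r) top′) (∙-congʳ B′)))))))
           (∙-cong (^^-cong w (sym (ℕ.+-suc n (suc k)))) (≈-sym (≈-trans (U-≡ n (suc (suc k)) ssk↦) (∙-congʳ
               (≈-trans (fall-end n (suc k) sk↦) (∙-congʳ A′))))))) ⟩
    c ∙ (1+ w ^^ suc (n + n) ∙ U n (suc k) ⊞ w ^^ (n ∸ k) ∙ U n k ⊞ w ^^ (n + suc (suc k)) ∙ U n (suc (suc k))) ∎
    where
    n : ℕ
    n = r + suc (suc k)
    c A B X Z : PS
    c = 1- w ^^ suc n
    A = fall n k
    B = fall (n + n) r
    X = w ^^ r
    Z = w ^^ (n + suc k)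
    ssk↦ : n ∸ suc (suc k) ≡ r
    ssk↦ = ℕ.m+n∸n≡m r (suc (suc k))
    sk↦ : n ∸ suc k ≡ suc r
    sk↦ = trans (cong (_∸ suc k) (ℕ.+-suc r (suc k))) (ℕ.m+n∸n≡m (suc r) (suc k))
    k↦ : n ∸ k ≡ suc (suc r)
    k↦ = trans (cong (_∸ k) (trans (ℕ.+-suc r (suc k)) (cong suc (ℕ.+-suc r k)))) (ℕ.m+n∸n≡m (suc (suc r)) k)
    top : n + n ∸ r ≡ suc (n + suc k)
    top = trans (cong (_∸ r) (trans (ℕ.+-assoc r (suc (suc k)) n) (cong (λ m → r + m) (trans
        (ℕ.+-comm (suc (suc k)) n) (ℕ.+-suc n (suc k))))))
                (ℕ.m+n∸m≡n r (suc (n + suc k)))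
    top′ : n + n ∸ suc r ≡ n + suc k
    top′ = trans (cong (_∸ suc r) (trans (cong (_+ n) (ℕ.+-suc r (suc k))) (trans
        (ℕ.+-assoc (suc r) (suc k) n) (cong (λ m → suc r + m) (ℕ.+-comm (suc k) n)))))
                 (ℕ.m+n∸m≡n (suc r) (n + suc k))
    A′ : fall n (suc k) ≈ A ∙ 1- (w ∙ (w ∙ X))
    A′ = fall-end n k k↦
    B′ : fall (n + n) (suc r) ≈ B ∙ 1- (w ∙ Z)
    B′ = fall-end (n + n) r top
    2n : w ^^ (n + n) ≈ Z ∙ (w ∙ X)
    2n = ≈-trans (^^-cong w (trans (cong (λ m → n + m) (trans (ℕ.+-suc r (suc k)) (ℕ.+-comm (suc r) (suc k)))) (sym
        (ℕ.+-assoc n (suc k) (suc r)))))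
                 (^^-+ w (n + suc k) (suc r))

  UStep : ℕ → ℕ → Set
  UStep n k = U (suc n) (suc k) ≈
    1- w ^^ suc n ∙ (1+ w ^^ suc (n + n) ∙ U n (suc k) ⊞ w ^^ (n ∸ k) ∙ U n k ⊞ w ^^ (n + suc (suc k)) ∙ U n (suc (suc k)))

  U-step-+ : ∀ k o → UStep (o + k) k
  U-step-+ k zero          = U-step-last k
  U-step-+ k (suc zero)    = U-step-penultimate k
  U-step-+ k (suc (suc r)) = subst (λ n → UStep n k)
    (trans (ℕ.+-suc r (suc k)) (cong suc (ℕ.+-suc r k))) (U-step-inner k r)

  U-step : ∀ {n k} → k ≤ n → UStep n k
  U-step {n} {k} k≤n = subst (λ n → UStep n k) (ℕ.m∸n+n≡m k≤n) (U-step-+ k (n ∸ k))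

  -- The centre of the recurrence: the neighbours at 1 and -1 have the same value and the same
  -- weight w^(n+1), which accounts for the 2.
  U-step₀ : ∀ n → U (suc n) 0 ≈
    1- w ^^ suc n ∙ (1+ w ^^ suc (n + n) ∙ U n 0 ⊞ K (+ 2) ∙ w ^^ suc n ∙ U n 1)
  U-step₀ zero = solve 1 (λ w → con (+ 1) :* (con (+ 1) :* (con (+ 1) :+ :- (w :* (w :* con (+ 1))))) :=
    (con (+ 1) :+ :- (w :* con (+ 1))) :* ((con (+ 1) :+ w :* con (+ 1)) :* (con (+ 1) :* con (+ 1))
      :+ con (+ 2) :* (w :* con (+ 1)) :* (con (+ 1) :* (con (+ 1) :+ :- con (+ 1)) :* con (+ 1)))) ≈-refl w
  U-step₀ (suc m) = begin
    K (+ 1) ∙ fall (suc n + suc n) (suc (suc m))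
      ≈⟨ ∙-congˡ (≈-trans (fall-double n m) (∙-cong (⊞-congˡ (⊟-cong (∙-congˡ (∙-congˡ 2n)))) (∙-congʳ
          (⊞-congˡ (⊟-cong (∙-congˡ 2n)))))) ⟩
    K (+ 1) ∙ (1- (w ∙ (w ∙ (X ∙ X))) ∙ (1- (w ∙ (X ∙ X)) ∙ B))
      ≈⟨ solve 3 (λ w X B →
           con (+ 1) :* ((con (+ 1) :+ :- (w :* (w :* (X :* X)))) :* ((con (+ 1) :+ :- (w :* (X :* X))) :* B)) :=
           (con (+ 1) :+ :- (w :* X)) :* ((con (+ 1) :+ w :* (X :* X)) :* (con (+ 1) :* (B :* (con (+ 1) :+ :- (w :* X))))
             :+ con (+ 2) :* (w :* X) :* (con (+ 1) :* (con (+ 1) :+ :- X) :* B))) ≈-refl w X B ⟩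
    1- (w ∙ X) ∙ (1+ (w ∙ (X ∙ X)) ∙ (K (+ 1) ∙ (B ∙ 1- (w ∙ X))) ⊞ K (+ 2) ∙ (w ∙ X) ∙ (K (+ 1) ∙ 1- X ∙ B))
      ≈⟨ ∙-congˡ (⊞-congʳ (∙-cong (⊞-congˡ (∙-congˡ (≈-sym 2n))) (∙-congˡ (≈-sym (fall-end (n + n) m top))))) ⟩
    1- w ^^ suc n ∙ (1+ w ^^ suc (n + n) ∙ U n 0 ⊞ K (+ 2) ∙ w ^^ suc n ∙ U n 1) ∎
    where
    n : ℕ
    n = suc m
    B X : PS
    B = fall (n + n) m
    X = w ^^ n
    2n : w ^^ (n + n) ≈ X ∙ X
    2n = ^^-+ w n n
    top : n + n ∸ m ≡ suc n
    top = trans (cong (_∸ m) (sym (ℕ.+-suc m n))) (ℕ.m+n∸m≡n m (suc n))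

  -- The terms of index k and -k of the bilateral sum of s^k w^(k(k-1)/2). Since w = s t, the term
  -- of index -k is t^k w^(k(k-1)/2), so no inverse of s occurs. At k = 0 this is 2, whereas the sum
  -- contains that term once; `T` corrects it.
  T′ : ℕ → PS
  T′ k = w ^^ tri k ∙ (s ^^ k ⊞ t ^^ k)

  T : ℕ → PS
  T zero    = K (+ 1)
  T (suc k) = T′ (suc k)

  -- The two weights on the right are those with which `U n (suc k)` enters the recurrences for
  -- `U (suc n) (suc (suc k))` and `U (suc n) k`; this match is what makes the induction on n close.
  T-shift : ∀ {n k} → k < n →
    w ^^ n ∙ (s ⊞ t) ∙ T′ (suc k) ≈ w ^^ (n ∸ suc k) ∙ T′ (suc (suc k)) ⊞ w ^^ suc (n + k) ∙ T′ k
  T-shift {n} {k} k<n = begin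
    w ^^ n ∙ (s ⊞ t) ∙ T′ (suc k)
      ≈⟨ ∙-cong (∙-congʳ wⁿ) (∙-congʳ (^^-+ w k (tri k))) ⟩
    x ∙ (w ∙ y) ∙ (s ⊞ t) ∙ (y ∙ W ∙ (s ∙ a ⊞ t ∙ b))
      ≈⟨ solve 7 (λ s t x y W a b →
           x :* (s :* t :* y) :* (s :+ t) :* (y :* W :* (s :* a :+ t :* b)) :=
           x :* (s :* t :* y :* (y :* W) :* (s :* (s :* a) :+ t :* (t :* b)))
           :+ s :* t :* (x :* (s :* t :* y) :* y) :* (W :* (a :+ b))) ≈-refl s t x y W a b ⟩
    x ∙ (w ∙ y ∙ (y ∙ W) ∙ (s ∙ (s ∙ a) ⊞ t ∙ (t ∙ b))) ⊞ w ∙ (x ∙ (w ∙ y) ∙ y) ∙ (W ∙ (a ⊞ b))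
      ≈⟨ ⊞-cong (∙-congˡ (∙-congʳ (≈-trans (∙-congˡ (≈-sym (^^-+ w k (tri k))))
          (≈-sym (^^-+ w (suc k) (tri (suc k)))))))
                (∙-congʳ (∙-congˡ (≈-sym (≈-trans (^^-+ w n k) (∙-congʳ wⁿ))))) ⟩
    w ^^ (n ∸ suc k) ∙ T′ (suc (suc k)) ⊞ w ^^ suc (n + k) ∙ T′ k ∎
    where
    x y W a b : PS
    x = w ^^ (n ∸ suc k)
    y = w ^^ k
    W = w ^^ tri k
    a = s ^^ k
    b = t ^^ k
    wⁿ : w ^^ n ≈ x ∙ (w ∙ y)
    wⁿ = ≈-trans (^^-cong w (sym (ℕ.m∸n+n≡m k<n))) (^^-+ w (n ∸ suc k) (suc k))

  -- Up to boundary terms, the recurrence for U turns multiplication of the sum by the new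
  -- factor into a shift of the index, in the form T-shift.
  partial-sum-step : ∀ n K′ → K′ ≤ n →
    ∑ K′ (λ k → T k ∙ U (suc n) k) ⊞ 1- w ^^ suc n ∙ (w ^^ (n ∸ K′) ∙ T′ (suc K′) ∙ U n K′) ≈
    1- w ^^ suc n ∙ ((1+ w ^^ suc (n + n) ⊞ w ^^ n ∙ (s ⊞ t)) ∙ ∑ K′ (λ k → T k ∙ U n k) ⊞ w ^^ suc (n + K′) ∙ T′ K′ ∙ U n (suc K′))
  partial-sum-step n zero _ = begin
    K (+ 1) ∙ U (suc n) 0 ⊞ c ∙ (w ^^ n ∙ (K (+ 1) ∙ (s ∙ K (+ 1) ⊞ t ∙ K (+ 1))) ∙ U n 0)
      ≈⟨ ⊞-congʳ (∙-congˡ (U-step₀ n)) ⟩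
    K (+ 1) ∙ (c ∙ (α ∙ U n 0 ⊞ K (+ 2) ∙ w ^^ suc n ∙ U n 1)) ⊞ c ∙ (w ^^ n ∙ (K (+ 1) ∙ (s ∙ K (+ 1) ⊞ t ∙ K (+ 1))) ∙ U n 0)
      ≈⟨ solve 8 (λ s t c α z x u v →
           con (+ 1) :* (c :* (α :* u :+ con (+ 2) :* z :* v)) :+ c :* (x :* (con (+ 1) :* (s :* con (+ 1) :+ t :* con (+ 1))) :* u) :=
           c :* ((α :+ x :* (s :+ t)) :* (con (+ 1) :* u) :+ z :* (con (+ 1) :* (con (+ 1) :+ con (+ 1))) :* v))
           ≈-refl s t c α (w ^^ suc n) (w ^^ n) (U n 0) (U n 1) ⟩
    c ∙ ((α ⊞ w ^^ n ∙ (s ⊞ t)) ∙ (K (+ 1) ∙ U n 0) ⊞ w ^^ suc n ∙ (K (+ 1) ∙ (K (+ 1) ⊞ K (+ 1))) ∙ U n 1)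
      ≈⟨ ∙-congˡ (⊞-congˡ (∙-congʳ (∙-congʳ (^^-cong w (cong suc (sym (ℕ.+-identityʳ n))))))) ⟩
    c ∙ ((α ⊞ w ^^ n ∙ (s ⊞ t)) ∙ (K (+ 1) ∙ U n 0) ⊞ w ^^ suc (n + 0) ∙ T′ 0 ∙ U n 1) ∎
    where
    c α : PS
    c = 1- w ^^ suc n
    α = 1+ w ^^ suc (n + n)
  partial-sum-step n (suc k) k<n = begin
    S₁ ⊞ T₁ ∙ U (suc n) (suc k) ⊞ c ∙ (x₁ ∙ T₂ ∙ u₁)
      ≈⟨ ⊞-congʳ (⊞-congˡ (∙-congˡ (U-step (ℕ.<⇒≤ k<n)))) ⟩
    S₁ ⊞ T₁ ∙ (c ∙ (α ∙ u₁ ⊞ x₀ ∙ u₀ ⊞ z₁ ∙ u₂)) ⊞ c ∙ (x₁ ∙ T₂ ∙ u₁)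
      ≈⟨ solve 11 (λ S₁ T₁ c α u₁ x₀ u₀ z₁ u₂ x₁ T₂ →
           S₁ :+ T₁ :* (c :* (α :* u₁ :+ x₀ :* u₀ :+ z₁ :* u₂)) :+ c :* (x₁ :* T₂ :* u₁) :=
           S₁ :+ c :* (x₀ :* T₁ :* u₀) :+ c :* (α :* (T₁ :* u₁) :+ z₁ :* T₁ :* u₂ :+ x₁ :* T₂ :* u₁))
           ≈-refl S₁ T₁ c α u₁ x₀ u₀ z₁ u₂ x₁ T₂ ⟩
    S₁ ⊞ c ∙ (x₀ ∙ T₁ ∙ u₀) ⊞ c ∙ (α ∙ (T₁ ∙ u₁) ⊞ z₁ ∙ T₁ ∙ u₂ ⊞ x₁ ∙ T₂ ∙ u₁)
      ≈⟨ ⊞-congʳ (partial-sum-step n k (ℕ.<⇒≤ k<n)) ⟩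
    c ∙ ((α ⊞ M) ∙ S₀ ⊞ z₀ ∙ T′ k ∙ u₁) ⊞ c ∙ (α ∙ (T₁ ∙ u₁) ⊞ z₁ ∙ T₁ ∙ u₂ ⊞ x₁ ∙ T₂ ∙ u₁)
      ≈⟨ solve 12 (λ c α M S₀ z₀ T₀ u₁ T₁ z₁ u₂ x₁ T₂ →
           c :* ((α :+ M) :* S₀ :+ z₀ :* T₀ :* u₁) :+ c :* (α :* (T₁ :* u₁) :+ z₁ :* T₁ :* u₂ :+ x₁ :* T₂ :* u₁) :=
           c :* ((α :+ M) :* S₀ :+ α :* (T₁ :* u₁) :+ (x₁ :* T₂ :+ z₀ :* T₀) :* u₁ :+ z₁ :* T₁ :* u₂))
           ≈-refl c α M S₀ z₀ (T′ k) u₁ T₁ z₁ u₂ x₁ T₂ ⟩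
    c ∙ ((α ⊞ M) ∙ S₀ ⊞ α ∙ (T₁ ∙ u₁) ⊞ (x₁ ∙ T₂ ⊞ z₀ ∙ T′ k) ∙ u₁ ⊞ z₁ ∙ T₁ ∙ u₂)
      ≈⟨ ∙-congˡ (⊞-cong (⊞-congˡ (∙-congʳ (≈-sym (T-shift k<n)))) (∙-congʳ (∙-congʳ (^^-cong w
          (ℕ.+-suc n (suc k)))))) ⟩
    c ∙ ((α ⊞ M) ∙ S₀ ⊞ α ∙ (T₁ ∙ u₁) ⊞ M ∙ T₁ ∙ u₁ ⊞ z₂ ∙ T₁ ∙ u₂)
      ≈⟨ solve 8 (λ c α M S₀ T₁ u₁ z₂ u₂ →
           c :* ((α :+ M) :* S₀ :+ α :* (T₁ :* u₁) :+ M :* T₁ :* u₁ :+ z₂ :* T₁ :* u₂) :=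
           c :* ((α :+ M) :* (S₀ :+ T₁ :* u₁) :+ z₂ :* T₁ :* u₂)) ≈-refl c α M S₀ T₁ u₁ z₂ u₂ ⟩
    c ∙ ((α ⊞ M) ∙ (S₀ ⊞ T₁ ∙ u₁) ⊞ z₂ ∙ T₁ ∙ u₂) ∎
    where
    c α M S₀ S₁ T₁ T₂ u₀ u₁ u₂ x₀ x₁ z₀ z₁ z₂ : PS
    c = 1- w ^^ suc n
    α = 1+ w ^^ suc (n + n)
    M = w ^^ n ∙ (s ⊞ t)
    S₀ = ∑ k (λ k → T k ∙ U n k)
    S₁ = ∑ k (λ k → T k ∙ U (suc n) k)
    T₁ = T′ (suc k)
    T₂ = T′ (suc (suc k))
    u₀ = U n k
    u₁ = U n (suc k)
    u₂ = U n (suc (suc k))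
    x₀ = w ^^ (n ∸ k)
    x₁ = w ^^ (n ∸ suc k)
    z₀ = w ^^ suc (n + k)
    z₁ = w ^^ (n + suc (suc k))
    z₂ = w ^^ suc (n + suc k)

  jacobi-factor : ℕ → PS
  jacobi-factor j = 1- w ^^ suc j ∙ (1+ (s ∙ w ^^ j) ∙ 1+ (t ∙ w ^^ j))

  -- With x = w^n, the new factor is (1 - w^(n+1)) (1 + w x² + x (s + t)). Its effect on the sum is
  -- `partial-sum-step` taken at the full range: one boundary term contains `U n (suc n)` and
  -- vanishes, the other becomes the new top term.
  finite-jacobi : ∀ n → ∏ n jacobi-factor ≈ ∑ n (λ k → T k ∙ U n k)
  finite-jacobi zero    = solve 0 (con (+ 1) := con (+ 1) :* (con (+ 1) :* con (+ 1))) ≈-refl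
  finite-jacobi (suc n) = begin
    ∏ n jacobi-factor ∙ (c ∙ (1+ (s ∙ x) ∙ 1+ (t ∙ x)))
      ≈⟨ ∙-congʳ (finite-jacobi n) ⟩
    S₀ ∙ (c ∙ (1+ (s ∙ x) ∙ 1+ (t ∙ x)))
      ≈⟨ solve 5 (λ s t S₀ c x →
           S₀ :* (c :* ((con (+ 1) :+ s :* x) :* (con (+ 1) :+ t :* x))) :=
           c :* ((con (+ 1) :+ s :* t :* (x :* x) :+ x :* (s :+ t)) :* S₀)) ≈-refl s t S₀ c x ⟩
    c ∙ ((1+ (w ∙ (x ∙ x)) ⊞ x ∙ (s ⊞ t)) ∙ S₀)
      ≈⟨ ∙-congˡ (≈-trans (∙-congʳ (⊞-congʳ (⊞-congˡ (∙-congˡ (≈-sym (^^-+ w n n)))))) (≈-trans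
           (solve 2 (λ a b → a := a :+ b :* con (+ 0)) ≈-refl _ (w ^^ suc (n + n) ∙ T′ n))
           (⊞-congˡ (∙-congˡ (≈-sym (U-beyond n)))))) ⟩
    c ∙ ((1+ w ^^ suc (n + n) ⊞ x ∙ (s ⊞ t)) ∙ S₀ ⊞ w ^^ suc (n + n) ∙ T′ n ∙ U n (suc n))
      ≈⟨ partial-sum-step n n ℕ.≤-refl ⟨
    S₁ ⊞ c ∙ (w ^^ (n ∸ n) ∙ T′ (suc n) ∙ U n n)
      ≈⟨ ⊞-congˡ (≈-trans (∙-congˡ (∙-congʳ (∙-congʳ (^^-cong w (ℕ.n∸n≡0 n)))))
           (≈-trans (solve 3 (λ c T u → c :* (con (+ 1) :* T :* u) := T :* (c :* u)) ≈-refl c (T′ (suc n)) (U n n))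
             (∙-congˡ (≈-sym (U-diagonal n))))) ⟩
    S₁ ⊞ T (suc n) ∙ U (suc n) (suc n) ∎
    where
    c x S₀ S₁ : PS
    c = 1- w ^^ suc n
    x = w ^^ n
    S₀ = ∑ n (λ k → T k ∙ U n k)
    S₁ = ∑ n (λ k → T k ∙ U (suc n) k)

-- Infinite products

infix 4 _⟶_
-- Convergence with a fixed rate: the N-th approximant is exact modulo q^N. With a common rate,
-- limits are multiplied term by term, without choosing moduli.
record _⟶_ (F : ℕ → PS) (f : PS) : Set where
  constructor mk⟶
  field upTo : ∀ N → F N ≈[ N ] f
open _⟶_ public

⟶-unique : ∀ {F f g} → F ⟶ f → F ⟶ g → f ≈ g
⟶-unique p r = mk≈ λ n → trans (sym (below (upTo p (suc n)) ℕ.≤-refl)) (below (upTo r (suc n)) ℕ.≤-refl)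

⟶-∙ : ∀ {F G f g} → F ⟶ f → G ⟶ g → (λ N → F N ∙ G N) ⟶ f ∙ g
⟶-∙ p r = mk⟶ λ N → ∙-cong[] (upTo p N) (upTo r N)

⟶-resp : ∀ {F G f} → (∀ N → F N ≈[ N ] G N) → F ⟶ f → G ⟶ f
⟶-resp F≈G p = mk⟶ λ N → ≈[]-trans (≈[]-sym (F≈G N)) (upTo p N)

⟶-cong : ∀ {F G f} → (∀ N → F N ≈ G N) → F ⟶ f → G ⟶ f
⟶-cong F≈G = ⟶-resp λ N → ≈⇒≈[] (F≈G N)

⟶-subsequence : ∀ {F f} (h : ℕ → ℕ) → (∀ N → N ≤ h N) → F ⟶ f → (λ N → F (h N)) ⟶ f
⟶-subsequence h N≤h p = mk⟶ λ N → ≈[]-mono (N≤h N) (upTo p (h N))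

∏∞ : (ℕ → PS) → PS
∏∞ F n = ∏ (suc n) F n

K-1-∙[] : ∀ {f g N} → g ≈[ N ] K (+ 1) → f ∙ g ≈[ N ] f
K-1-∙[] {f} g≈1 = ≈[]-trans (∙-cong[] ≈[]-refl g≈1) (≈⇒≈[] (solve 1 (λ f → f :* con (+ 1) := f) ≈-refl f))

-- Factors of index at least N are 1 modulo q^N, so appending them to the product of the first N
-- leaves all coefficients below N alone.
∏-⟶-∏∞ : ∀ F → (∀ j → F j ≈[ suc j ] K (+ 1)) → (λ N → ∏ N F) ⟶ ∏∞ F
∏-⟶-∏∞ F F≈1 = mk⟶ λ N → mk≈[] λ {n} n<N →
  trans (cong (λ m → ∏ m F n) (sym (ℕ.m∸n+n≡m n<N))) (below (stable (suc n) (N ∸ suc n)) ℕ.≤-refl)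
  where
  stable : ∀ N d → ∏ (d + N) F ≈[ N ] ∏ N F
  stable N zero    = ≈[]-refl
  stable N (suc d) = ≈[]-trans (K-1-∙[] (≈[]-mono (ℕ.m≤n⇒m≤1+n (ℕ.m≤n+m N d)) (F≈1 (d + N)))) (stable N d)

∏-cong : ∀ n {F G} → (∀ j → F j ≈ G j) → ∏ n F ≈ ∏ n G
∏-cong zero    F≈G = ≈-refl
∏-cong (suc n) F≈G = ∙-cong (∏-cong n F≈G) (F≈G n)

∏-∙ : ∀ n F G → ∏ n (λ j → F j ∙ G j) ≈ ∏ n F ∙ ∏ n G
∏-∙ zero    F G = solve 0 (con (+ 1) := con (+ 1) :* con (+ 1)) ≈-refl
∏-∙ (suc n) F G = ≈-trans (∙-congʳ (∏-∙ n F G))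
  (solve 4 (λ a b c d → a :* b :* (c :* d) := a :* c :* (b :* d)) ≈-refl (∏ n F) (∏ n G) (F n) (G n))

∑-cong[] : ∀ n {F G N} → (∀ {k} → k ≤ n → F k ≈[ N ] G k) → ∑ n F ≈[ N ] ∑ n G
∑-cong[] zero    F≈G = F≈G z≤n
∑-cong[] (suc n) F≈G = ⊞-cong[] (∑-cong[] n (λ k≤n → F≈G (ℕ.m≤n⇒m≤1+n k≤n))) (F≈G ℕ.≤-refl)

fac : ℤ → ℕ → PS
fac σ e = K (+ 1) ⊞ K σ ∙ mono e

fac-cong : ∀ σ {e e′} → e ≡ e′ → fac σ e ≈ fac σ e′
fac-cong σ refl = ≈-refl

fac-≈[] : ∀ σ {e N} → N ≤ e → fac σ e ≈[ N ] K (+ 1)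
fac-≈[] σ N≤e = ≈[]-trans (⊞-cong[] ≈[]-refl (∙-cong[] ≈[]-refl (mono-≈[] N≤e)))
  (≈⇒≈[] (solve 1 (λ s → con (+ 1) :+ s :* con (+ 0) := con (+ 1)) ≈-refl (K σ)))

fac-neg : ∀ e → fac -1ℤ e ≈ 1- mono e
fac-neg e = solve 1 (λ m → con (+ 1) :+ con -1ℤ :* m := con (+ 1) :+ :- m) ≈-refl (mono e)

poch± : ℤ → ℕ → ℕ → PS
poch± σ a d = ∏∞ (λ j → fac σ (a + d * j))

poch±-⟶ : ∀ σ a d → (λ N → ∏ N (λ j → fac σ (suc a + suc d * j))) ⟶ poch± σ (suc a) (suc d)
poch±-⟶ σ a d = ∏-⟶-∏∞ _ λ j → fac-≈[] σ (s≤s (ℕ.≤-trans (ℕ.m≤m+n j (d * j)) (ℕ.m≤n+m _ a)))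

finPoch-∏ : ∀ a d N → finPoch a d N ≈ ∏ N (λ j → fac -1ℤ (a + d * j))
finPoch-∏ a d zero    = ≈-sym K-1
finPoch-∏ a d (suc N) = ≈-trans (≈-sym (∙≈⊛ (finPoch a d N) (oneMinusMono (a + d * N))))
  (∙-cong (finPoch-∏ a d N) (≈-trans (oneMinusMono-≈ (a + d * N)) (≈-sym (fac-neg (a + d * N)))))

poch-poch± : ∀ a d → poch a d ≈ poch± -1ℤ a d
poch-poch± a d = mk≈ λ n → at (finPoch-∏ a d (suc n)) n

∑-⟶-resp : ∀ {F : ℕ → ℕ → PS} {G : ℕ → PS} {f} → (∀ N {k} → k ≤ N → F N k ≈[ N ] G k) → (λ N → ∑ N (F N)) ⟶ f → (λ N → ∑ N G) ⟶ f
∑-⟶-resp {F} {G} F≈G = ⟶-resp {F = λ N → ∑ N (F N)} λ N → ∑-cong[] N (F≈G N)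

-- Theta series and the Jacobi triple product

-- The terms ±k of Σ_{k ∈ ℤ} σ^k q^((a+b) k(k-1)/2 + a k), taken together.
θ-pair : ℤ → ℕ → ℕ → ℕ → PS
θ-pair σ a b k = K (σ ℤ.^ k) ∙ (mono ((a + b) * tri k + a * k) ⊞ mono ((a + b) * tri k + b * k))

θ-term : ℤ → ℕ → ℕ → ℕ → PS
θ-term σ a b zero    = K (+ 1)
θ-term σ a b (suc k) = θ-pair σ a b (suc k)

-- The specialization s = σ q^a, t = σ q^b. Because σ² = 1, w = q^(a+b) carries no sign; a and b are
-- successors so that all exponents in the products are positive.
module JacobiTripleProduct (σ : ℤ) (σ²≡1 : σ ℤ.* σ ≡ + 1) (a′ b′ : ℕ) where

  a b d : ℕ
  a = suc a′
  b = suc b′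
  d = a + b

  open FiniteJacobi (K σ ∙ mono a) (K σ ∙ mono b)

  power-signed : ∀ c k → (K σ ∙ mono c) ^^ k ≈ K (σ ℤ.^ k) ∙ mono (c * k)
  power-signed c zero    = ≈-trans (solve 0 (con (+ 1) :=
      con (+ 1) :* con (+ 1)) ≈-refl) (∙-congˡ (mono-cong (sym (ℕ.*-zeroʳ c))))
  power-signed c (suc k) = ≈-trans (∙-congˡ (power-signed c k)) (≈-trans
    (solve 4 (λ s m u v → s :* m :* (u :* v) := s :* u :* (m :* v))
        ≈-refl (K σ) (mono c) (K (σ ℤ.^ k)) (mono (c * k)))
    (∙-cong (≈-sym (K-* σ (σ ℤ.^ k))) (≈-trans (≈-sym (mono-+ c (c * k))) (mono-cong (sym (ℕ.*-suc c k))))))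

  w≈ : w ≈ mono d
  w≈ = ≈-trans (solve 3 (λ s m n → s :* m :* (s :* n) := s :* s :* (m :* n)) ≈-refl (K σ) (mono a) (mono b))
    (≈-trans (∙-cong (≈-trans (≈-sym (K-* σ σ)) (≈-reflexive (cong K σ²≡1))) (≈-sym (mono-+ a b))) (K-1-∙ (mono d)))

  w^^≈ : ∀ k → w ^^ k ≈ mono (d * k)
  w^^≈ zero    = mono-cong (sym (ℕ.*-zeroʳ d))
  w^^≈ (suc k) = ≈-trans (∙-cong w≈ (w^^≈ k)) (≈-trans (≈-sym (mono-+ d (d * k))) (mono-cong (sym (ℕ.*-suc d k))))

  jacobi-factor≈ : ∀ j → jacobi-factor j ≈ fac -1ℤ (d + d * j) ∙ (fac σ (a + d * j) ∙ fac σ (b + d * j))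
  jacobi-factor≈ j = ∙-cong
    (≈-trans (⊞-congˡ (⊟-cong (≈-trans (w^^≈ (suc j)) (mono-cong (ℕ.*-suc d j))))) (≈-sym (fac-neg (d + d * j))))
    (∙-cong (signed a) (signed b))
    where
    signed : ∀ c → 1+ (K σ ∙ mono c ∙ w ^^ j) ≈ fac σ (c + d * j)
    signed c = ⊞-congˡ (≈-trans (∙-congˡ (w^^≈ j))
      (≈-trans (solve 3 (λ s m n → s :* m :* n := s :* (m :* n)) ≈-refl (K σ) (mono c) (mono (d * j)))
        (∙-congˡ (≈-sym (mono-+ c (d * j))))))

  T′≈ : ∀ k → T′ k ≈ θ-pair σ a b k
  T′≈ k = ≈-trans (∙-cong (w^^≈ (tri k)) (⊞-cong (power-signed a k) (power-signed b k)))
    (≈-trans (solve 4 (λ w s m n → w :* (s :* m :+ s :* n) := s :* (w :* m :+ w :* n)) ≈-refl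
        (mono (d * tri k)) (K (σ ℤ.^ k)) (mono (a * k)) (mono (b * k)))
      (∙-congˡ (⊞-cong (≈-sym (mono-+ (d * tri k) (a * k))) (≈-sym (mono-+ (d * tri k) (b * k))))))

  T≈ : ∀ k → T k ≈ θ-term σ a b k
  T≈ zero    = ≈-refl
  T≈ (suc k) = T′≈ (suc k)

  fall-≈[] : ∀ n k → fall n k ≈[ n ∸ k ] K (+ 1)
  fall-≈[] n zero    = ≈[]-refl
  fall-≈[] n (suc k) = ≈[]-trans
    (K-1-∙[] (≈[]-trans (≈⇒≈[] (≈-trans (⊞-congˡ (⊟-cong (w^^≈ (n ∸ k)))) (≈-sym (fac-neg (d * (n ∸ k))))))
      (fac-≈[] -1ℤ (ℕ.≤-trans (ℕ.∸-monoʳ-≤ n (ℕ.n≤1+n k)) (ℕ.m≤m+n (n ∸ k) _)))))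
    (≈[]-mono (ℕ.∸-monoʳ-≤ n (ℕ.n≤1+n k)) (fall-≈[] n k))

  U-≈[] : ∀ n k → U n k ≈[ n ∸ k ] K (+ 1)
  U-≈[] n k = ≈[]-trans
    (K-1-∙[] (≈[]-mono (subst (n ∸ k ≤_) (sym (ℕ.+-∸-assoc n (ℕ.m∸n≤m n k))) (ℕ.≤-trans (ℕ.m∸n≤m n k)
        (ℕ.m≤m+n n _))) (fall-≈[] (n + n) (n ∸ k))))
    (fall-≈[] n k)

  -- `U n k` is 1 only modulo q^(n-k), but the monomials of the k-th pair have exponent at least k,
  -- and this makes up the missing precision.
  θ-term-U : ∀ n {k} → k ≤ n → T k ∙ U n k ≈[ n ] θ-term σ a b k
  θ-term-U n {zero}  _   = ≈[]-trans (K-1-∙[] (U-≈[] n 0)) ≈[]-refl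
  θ-term-U n {suc k} k<n = ≈[]-trans (≈⇒≈[] (∙-congʳ (T≈ (suc k))))
    (≈[]-trans (≈⇒≈[] (expand (U n (suc k))))
      (≈[]-trans (∙-cong[] ≈[]-refl (⊞-cong[] (negligible a′) (negligible b′)))
        (≈⇒≈[] (≈-trans (≈-sym (expand (K (+ 1)))) (solve 1 (λ f → f :* con (+ 1) := f) ≈-refl _)))))
    where
    e : ℕ → ℕ
    e c = d * tri (suc k) + suc c * suc k
    expand : ∀ u → θ-pair σ a b (suc k) ∙ u ≈ K (σ ℤ.^ suc k) ∙ (mono (e a′) ∙ u ⊞ mono (e b′) ∙ u)
    expand u = solve 4 (λ s m n u → s :* (m :+ n) :* u := s :* (m :* u :+ n :* u))
        ≈-refl (K (σ ℤ.^ suc k)) (mono (e a′)) (mono (e b′)) u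
    negligible : ∀ c → mono (e c) ∙ U n (suc k) ≈[ n ] mono (e c) ∙ K (+ 1)
    negligible c = ≈[]-mono
      (ℕ.≤-trans (ℕ.≤-reflexive (sym (ℕ.m+[n∸m]≡n k<n)))
        (ℕ.+-monoˡ-≤ (n ∸ suc k) (ℕ.≤-trans (ℕ.m≤m+n (suc k) (c * suc k)) (ℕ.m≤n+m _ (d * tri (suc k))))))
      (mono-∙-cong[] (e c) (U-≈[] n (suc k)))

  jacobi-triple-product : (λ N → ∑ N (θ-term σ a b)) ⟶ poch± -1ℤ d d ∙ (poch± σ a d ∙ poch± σ b d)
  jacobi-triple-product = ∑-⟶-resp {F = λ N k → T k ∙ U N k} {G = θ-term σ a b} (λ N → θ-term-U N) (⟶-cong finite
    (⟶-∙ (poch±-⟶ -1ℤ (a′ + b) (a′ + b)) (⟶-∙ (poch±-⟶ σ a′ (a′ + b)) (poch±-⟶ σ b′ (a′ + b)))))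
    where
    finite : ∀ N → ∏ N (λ j → fac -1ℤ (d + d * j)) ∙ (∏ N (λ j → fac σ (a + d * j)) ∙ ∏ N (λ j → fac σ (b + d * j)))
      ≈ ∑ N (λ k → T k ∙ U N k)
    finite N = ≈-trans (≈-sym (≈-trans (∏-∙ N _ _) (∙-congˡ (∏-∙ N _ _)))) (≈-trans
        (≈-sym (∏-cong N jacobi-factor≈)) (finite-jacobi N))

open JacobiTripleProduct public using (jacobi-triple-product)

-- Splitting infinite products by residue classes

∏-split₂ : ∀ N F → ∏ (N * 2) F ≈ ∏ N (λ j → F (j * 2)) ∙ ∏ N (λ j → F (1 + j * 2))
∏-split₂ zero    F = solve 0 (con (+ 1) := con (+ 1) :* con (+ 1)) ≈-refl
∏-split₂ (suc N) F = ≈-trans (∙-congʳ (∙-congʳ (∏-split₂ N F)))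
  (solve 4 (λ a b c d → a :* b :* c :* d := a :* c :* (b :* d)) ≈-refl
    (∏ N (λ j → F (j * 2))) (∏ N (λ j → F (1 + j * 2))) (F (N * 2)) (F (1 + N * 2)))

∏-split₃ : ∀ N F → ∏ (N * 3) F ≈ ∏ N (λ j → F (j * 3)) ∙ ∏ N (λ j → F (1 + j * 3)) ∙ ∏ N (λ j → F (2 + j * 3))
∏-split₃ zero    F = solve 0 (con (+ 1) := con (+ 1) :* con (+ 1) :* con (+ 1)) ≈-refl
∏-split₃ (suc N) F = ≈-trans (∙-congʳ (∙-congʳ (∙-congʳ (∏-split₃ N F))))
  (solve 6 (λ a b c d e f → a :* b :* c :* d :* e :* f := a :* d :* (b :* e) :* (c :* f)) ≈-refl
    (∏ N (λ j → F (j * 3))) (∏ N (λ j → F (1 + j * 3))) (∏ N (λ j → F (2 + j * 3))) (F (N * 3)) (F (1 + N * 3)) (F (2 + N * 3)))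

poch±-split₂ : ∀ σ a d → let a = suc a; d = suc d in
  poch± σ a (d + d) ∙ poch± σ (a + d) (d + d) ≈ poch± σ a d
poch±-split₂ σ a′ d′ = ⟶-unique
  (⟶-cong finite (⟶-∙ (poch±-⟶ σ a′ (d′ + d)) (poch±-⟶ σ (a′ + d) (d′ + d))))
  (⟶-subsequence (_* 2) (λ N → ℕ.m≤m*n N 2) (poch±-⟶ σ a′ d′))
  where
  a d : ℕ
  a = suc a′
  d = suc d′
  even : ∀ a d j → a + (d + d) * j ≡ a + d * (j * 2)
  even = solve-∀
  odd : ∀ a d j → a + d + (d + d) * j ≡ a + d * (1 + j * 2)
  odd = solve-∀
  finite : ∀ N →
      ∏ N (λ j → fac σ (a + (d + d) * j)) ∙ ∏ N (λ j → fac σ (a + d + (d + d) * j)) ≈ ∏ (N * 2) (λ j → fac σ (a + d * j))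
  finite N = ≈-sym (≈-trans (∏-split₂ N _)
    (∙-cong (∏-cong N (λ j → fac-cong σ (sym (even a d j)))) (∏-cong N (λ j → fac-cong σ (sym (odd a d j))))))

poch±-split₃ : ∀ σ a d → let a = suc a; d = suc d; t = d + d + d in
  poch± σ a t ∙ poch± σ (a + d) t ∙ poch± σ (a + d + d) t ≈ poch± σ a d
poch±-split₃ σ a′ d′ = ⟶-unique
  (⟶-cong finite (⟶-∙ (⟶-∙ (poch±-⟶ σ a′ (d′ + d + d)) (poch±-⟶ σ (a′ + d) (d′ + d + d))) (poch±-⟶ σ (a′ + d + d) (d′ + d + d))))
  (⟶-subsequence (_* 3) (λ N → ℕ.m≤m*n N 3) (poch±-⟶ σ a′ d′))
  where
  a d : ℕ
  a = suc a′
  d = suc d′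
  class₀ : ∀ a d j → a + (d + d + d) * j ≡ a + d * (j * 3)
  class₀ = solve-∀
  class₁ : ∀ a d j → a + d + (d + d + d) * j ≡ a + d * (1 + j * 3)
  class₁ = solve-∀
  class₂ : ∀ a d j → a + d + d + (d + d + d) * j ≡ a + d * (2 + j * 3)
  class₂ = solve-∀
  finite : ∀ N →
      ∏ N (λ j → fac σ (a + (d + d + d) * j)) ∙ ∏ N (λ j → fac σ (a + d + (d + d + d) * j)) ∙ ∏ N (λ j → fac σ (a + d + d + (d + d + d) * j))
    ≈ ∏ (N * 3) (λ j → fac σ (a + d * j))
  finite N = ≈-sym (≈-trans (∏-split₃ N _) (∙-cong (∙-cong
    (∏-cong N (λ j → fac-cong σ (sym (class₀ a d j)))) (∏-cong N (λ j → fac-cong σ (sym (class₁ a d j)))))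
    (∏-cong N (λ j → fac-cong σ (sym (class₂ a d j))))))

poch±-conjugate : ∀ a d → let a = suc a; d = suc d in
  poch± -1ℤ a d ∙ poch± (+ 1) a d ≈ poch± -1ℤ (a + a) (d + d)
poch±-conjugate a′ d′ = ⟶-unique
  (⟶-cong finite (⟶-∙ (poch±-⟶ -1ℤ a′ d′) (poch±-⟶ (+ 1) a′ d′)))
  (poch±-⟶ -1ℤ (a′ + a) (d′ + d))
  where
  a d : ℕ
  a = suc a′
  d = suc d′
  double : ∀ a d j → a + d * j + (a + d * j) ≡ a + a + (d + d) * j
  double = solve-∀
  factor : ∀ e → fac -1ℤ e ∙ fac (+ 1) e ≈ fac -1ℤ (e + e)
  factor e = ≈-trans
    (solve 1 (λ m → (con (+ 1) :+ con -1ℤ :* m) :* (con (+ 1) :+ con (+ 1) :* m) := con (+ 1) :+ con -1ℤ :* (m :* m))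
        ≈-refl (mono e))
    (⊞-congˡ (∙-congˡ (≈-sym (mono-+ e e))))
  finite : ∀ N →
      ∏ N (λ j → fac -1ℤ (a + d * j)) ∙ ∏ N (λ j → fac (+ 1) (a + d * j)) ≈ ∏ N (λ j → fac -1ℤ (a + a + (d + d) * j))
  finite N = ≈-trans (≈-sym (∏-∙ N _ _)) (∏-cong N (λ j → ≈-trans (factor (a + d * j)) (fac-cong -1ℤ (double a d j))))

-- Trisection

opaque
  sect : ℕ → PS → PS
  sect r f n = f (n * 3 + r)

opaque
  unfolding sect _∙_

  sect-at : ∀ r f n → sect r f n ≡ f (n * 3 + r)
  sect-at r f n = refl

  sect-cong : ∀ r {f g} → f ≈ g → sect r f ≈ sect r g
  sect-cong r f≈g = mk≈ λ n → at f≈g (n * 3 + r)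

  sect-⊞ : ∀ r f g → sect r (f ⊞ g) ≈ sect r f ⊞ sect r g
  sect-⊞ r f g = ≈-refl

  sect-K∙ : ∀ r c f → sect r (K c ∙ f) ≈ K c ∙ sect r f
  sect-K∙ r c f = mk≈ λ n → trans (at (K-⊛ c f) (n * 3 + r)) (sym (at (K-⊛ c (sect r f)) n))

  sect-0-qShift : ∀ f → sect 0 (qShift f) ≈ qShift (sect 2 f)
  sect-0-qShift f = mk≈ λ
    { zero    → refl
    ; (suc n) → cong f (trans (ℕ.+-identityʳ (2 + n * 3)) (ℕ.+-comm 2 (n * 3))) }

  sect-suc-qShift : ∀ r f → sect (suc r) (qShift f) ≈ sect r f
  sect-suc-qShift r f = mk≈ λ n → cong (qShift f) (ℕ.+-suc (n * 3) r)

  sect-⟶ : ∀ r {F f} → r < 3 → F ⟶ f → (h : ℕ → ℕ) → (∀ N → N * 3 ≤ h N) → (λ N → sect r (F (h N))) ⟶ sect r f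
  sect-⟶ r r<3 F⟶f h N*3≤h = mk⟶ λ N → mk≈[] λ {n} n<N → below (upTo F⟶f (h N))
    (ℕ.<-≤-trans (ℕ.<-≤-trans (ℕ.+-monoʳ-< (n * 3) r<3) (ℕ.≤-reflexive (ℕ.+-comm (n * 3) 3)))
      (ℕ.≤-trans (ℕ.*-monoˡ-≤ 3 n<N) (N*3≤h N)))

  head-tail : ∀ f → f ≈ K (f 0) ⊞ q ∙ tail f
  head-tail f = mk≈ λ { zero → sym (trans (cong (λ c → f 0 ℤ.+ c) (at (q-∙ (tail f)) 0)) (ℤ.+-identityʳ _))
                      ; (suc n) → sym (trans (ℤ.+-identityˡ _) (at (q-∙ (tail f)) (suc n))) }

  sect-tail : ∀ r f → sect r (tail f) ≈ sect (suc r) f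
  sect-tail r f = mk≈ λ n → cong f (sym (ℕ.+-suc (n * 3) r))

  sect-2-tail : ∀ f → sect 2 (tail f) ≈ tail (sect 0 f)
  sect-2-tail f = mk≈ λ n → cong (λ m → f (suc m)) (trans (ℕ.+-comm (n * 3) 2) (cong (λ m → suc (suc m)) (sym
      (ℕ.+-identityʳ (n * 3)))))

  sect-head : ∀ f → sect 0 f 0 ≡ f 0
  sect-head f = refl

sect-0-q∙ : ∀ f → sect 0 (q ∙ f) ≈ q ∙ sect 2 f
sect-0-q∙ f = ≈-trans (sect-cong 0 (q-∙ f)) (≈-trans (sect-0-qShift f) (≈-sym (q-∙ (sect 2 f))))

sect-suc-q∙ : ∀ r f → sect (suc r) (q ∙ f) ≈ sect r f
sect-suc-q∙ r f = ≈-trans (sect-cong (suc r) (q-∙ f)) (sect-suc-qShift r f)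

sect-∙-unroll : ∀ r f g → sect r (f ∙ g) ≈ K (f 0) ∙ sect r g ⊞ sect r (q ∙ (tail f ∙ g))
sect-∙-unroll r f g = ≈-trans
  (sect-cong r (≈-trans (∙-congʳ (head-tail f))
    (solve 4 (λ c q t g → (c :+ q :* t) :* g := c :* g :+ q :* (t :* g)) ≈-refl (K (f 0)) q (tail f) g)))
  (≈-trans (sect-⊞ r (K (f 0) ∙ g) (q ∙ (tail f ∙ g))) (⊞-congʳ (sect-K∙ r (f 0) g)))

sect-0-head-tail : ∀ f → sect 0 f ≈ K (f 0) ⊞ q ∙ sect 2 (tail f)
sect-0-head-tail f = ≈-trans (head-tail (sect 0 f))
  (⊞-cong (≈-reflexive (cong K (sect-head f))) (∙-congˡ (≈-sym (sect-2-tail f))))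

product₀ product₁ product₂ : PS → PS → PS → PS → PS → PS → PS
product₀ a b c a′ b′ c′ = a ∙ a′ ⊞ q ∙ (b ∙ c′ ⊞ c ∙ b′)
product₁ a b c a′ b′ c′ = a ∙ b′ ⊞ b ∙ a′ ⊞ q ∙ (c ∙ c′)
product₂ a b c a′ b′ c′ = a ∙ c′ ⊞ b ∙ b′ ⊞ c ∙ a′

sections : (PS → PS → PS → PS → PS → PS → PS) → PS → PS → PS
sections p f g = p (sect 0 f) (sect 1 f) (sect 2 f) (sect 0 g) (sect 1 g) (sect 2 g)

private
  -- The three combinations of sections obey the recursion that `sect-∙-unroll` gives for the
  -- sections of a product: removing the head of `f` rotates its sections, with a factor q at the
  -- wrap from 0 to 2.
  step₀ : ∀ f g → sections product₀ f g ≈ K (f 0) ∙ sect 0 g ⊞ q ∙ sections product₂ (tail f) g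
  step₀ f g = ≈-trans (⊞-cong (∙-congʳ (sect-0-head-tail f)) (∙-congˡ (⊞-cong (∙-congʳ (≈-sym (sect-tail 0 f)))
      (∙-congʳ (≈-sym (sect-tail 1 f))))))
    (solve 8 (λ k q c′ x y z b c → (k :+ q :* c′) :* x :+ q :* (b :* z :+ c :* y) :=
        k :* x :+ q :* (b :* z :+ c :* y :+ c′ :* x)) ≈-refl
      (K (f 0)) q (sect 2 (tail f)) (sect 0 g) (sect 1 g) (sect 2 g) (sect 0 (tail f)) (sect 1 (tail f)))

  step₁ : ∀ f g → sections product₁ f g ≈ K (f 0) ∙ sect 1 g ⊞ sections product₀ (tail f) g
  step₁ f g = ≈-trans (⊞-cong (⊞-cong (∙-congʳ (sect-0-head-tail f)) (∙-congʳ (≈-sym (sect-tail 0 f)))) (∙-congˡ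
      (∙-congʳ (≈-sym (sect-tail 1 f)))))
    (solve 8 (λ k q c′ x y z b c → (k :+ q :* c′) :* y :+ b :* x :+ q :* (c :* z) :=
        k :* y :+ (b :* x :+ q :* (c :* z :+ c′ :* y))) ≈-refl
      (K (f 0)) q (sect 2 (tail f)) (sect 0 g) (sect 1 g) (sect 2 g) (sect 0 (tail f)) (sect 1 (tail f)))

  step₂ : ∀ f g → sections product₂ f g ≈ K (f 0) ∙ sect 2 g ⊞ sections product₁ (tail f) g
  step₂ f g = ≈-trans (⊞-cong (⊞-cong (∙-congʳ (sect-0-head-tail f)) (∙-congʳ (≈-sym (sect-tail 0 f)))) (∙-congʳ
      (≈-sym (sect-tail 1 f))))
    (solve 8 (λ k q c′ x y z b c → (k :+ q :* c′) :* z :+ b :* y :+ c :* x :=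
        k :* z :+ (b :* y :+ c :* x :+ q :* (c′ :* z))) ≈-refl
      (K (f 0)) q (sect 2 (tail f)) (sect 0 g) (sect 1 g) (sect 2 g) (sect 0 (tail f)) (sect 1 (tail f)))

  -- Each rule removes the head of `f` and passes to the section below it. Only section 0, which
  -- wraps to section 2 with a factor q, appeals to the smaller precision N, and that factor
  -- restores the lost degree.
  sect-∙[] : ∀ N f g → (sect 0 (f ∙ g) ≈[ N ] sections product₀ f g)
                     × (sect 1 (f ∙ g) ≈[ N ] sections product₁ f g)
                     × (sect 2 (f ∙ g) ≈[ N ] sections product₂ f g)
  sect-∙[] zero    f g = mk≈[] (λ ()) , mk≈[] (λ ()) , mk≈[] (λ ())
  sect-∙[] (suc N) f g = rule₀ f , rule₁ f , rule₂ f
    where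
    rule₀ : ∀ f → sect 0 (f ∙ g) ≈[ suc N ] sections product₀ f g
    rule₀ f = ≈[]-trans
      (≈[]-trans (≈⇒≈[] (≈-trans (sect-∙-unroll 0 f g) (⊞-congˡ (sect-0-q∙ (tail f ∙ g)))))
        (⊞-cong[] ≈[]-refl (mono-∙-cong[] 1 (proj₂ (proj₂ (sect-∙[] N (tail f) g))))))
      (≈⇒≈[] (≈-sym (step₀ f g)))
    rule₁ : ∀ f → sect 1 (f ∙ g) ≈[ suc N ] sections product₁ f g
    rule₁ f = ≈[]-trans
      (≈[]-trans (≈⇒≈[] (≈-trans (sect-∙-unroll 1 f g) (⊞-congˡ (sect-suc-q∙ 0 (tail f ∙ g)))))
        (⊞-cong[] ≈[]-refl (rule₀ (tail f))))
      (≈⇒≈[] (≈-sym (step₁ f g)))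
    rule₂ : ∀ f → sect 2 (f ∙ g) ≈[ suc N ] sections product₂ f g
    rule₂ f = ≈[]-trans
      (≈[]-trans (≈⇒≈[] (≈-trans (sect-∙-unroll 2 f g) (⊞-congˡ (sect-suc-q∙ 1 (tail f ∙ g)))))
        (⊞-cong[] ≈[]-refl (rule₁ (tail f))))
      (≈⇒≈[] (≈-sym (step₂ f g)))

≈[]⇒≈ : ∀ {f g} → (∀ N → f ≈[ N ] g) → f ≈ g
≈[]⇒≈ p = mk≈ λ n → below (p (suc n)) ℕ.≤-refl

-- f ▷⟨ a , b , c ⟩ says that f = a(q³) + q b(q³) + q² c(q³).
infix 4 _▷⟨_,_,_⟩

record _▷⟨_,_,_⟩ (f a b c : PS) : Set where
  constructor mk▷
  field
    part₀ : sect 0 f ≈ a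
    part₁ : sect 1 f ≈ b
    part₂ : sect 2 f ≈ c
open _▷⟨_,_,_⟩ public

▷-∙ : ∀ {f g a b c a′ b′ c′} → f ▷⟨ a , b , c ⟩ → g ▷⟨ a′ , b′ , c′ ⟩ →
  (f ∙ g) ▷⟨ product₀ a b c a′ b′ c′ , product₁ a b c a′ b′ c′ , product₂ a b c a′ b′ c′ ⟩
▷-∙ {f} {g} (mk▷ a b c) (mk▷ a′ b′ c′) = mk▷
  (≈-trans (≈[]⇒≈ (λ N → proj₁ (sect-∙[] N f g))) (⊞-cong (∙-cong a a′) (∙-congˡ (⊞-cong (∙-cong b c′)
      (∙-cong c b′)))))
  (≈-trans (≈[]⇒≈ (λ N → proj₁ (proj₂ (sect-∙[] N f g)))) (⊞-cong (⊞-cong (∙-cong a b′) (∙-cong b a′)) (∙-congˡ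
      (∙-cong c c′))))
  (≈-trans (≈[]⇒≈ (λ N → proj₂ (proj₂ (sect-∙[] N f g)))) (⊞-cong (⊞-cong (∙-cong a c′) (∙-cong b b′)) (∙-cong c a′)))

▷-⊞ : ∀ {f g a b c a′ b′ c′} → f ▷⟨ a , b , c ⟩ → g ▷⟨ a′ , b′ , c′ ⟩ → (f ⊞ g) ▷⟨ a ⊞ a′ , b ⊞ b′ , c ⊞ c′ ⟩
▷-⊞ {f} {g} (mk▷ a b c) (mk▷ a′ b′ c′) = mk▷
  (≈-trans (sect-⊞ 0 f g) (⊞-cong a a′)) (≈-trans (sect-⊞ 1 f g) (⊞-cong b b′)) (≈-trans (sect-⊞ 2 f g) (⊞-cong c c′))

▷-K∙ : ∀ k {f a b c} → f ▷⟨ a , b , c ⟩ → (K k ∙ f) ▷⟨ K k ∙ a , K k ∙ b , K k ∙ c ⟩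
▷-K∙ k {f} (mk▷ a b c) = mk▷
  (≈-trans (sect-K∙ 0 k f) (∙-congˡ a)) (≈-trans (sect-K∙ 1 k f) (∙-congˡ b)) (≈-trans (sect-K∙ 2 k f) (∙-congˡ c))

▷-q∙ : ∀ {f a b c} → f ▷⟨ a , b , c ⟩ → (q ∙ f) ▷⟨ q ∙ c , a , b ⟩
▷-q∙ {f} (mk▷ a b c) = mk▷ (≈-trans (sect-0-q∙ f) (∙-congˡ c)) (≈-trans (sect-suc-q∙ 0 f) a)
    (≈-trans (sect-suc-q∙ 1 f) b)

▷-resp : ∀ {f f′ a a′ b b′ c c′} → f ≈ f′ → a ≈ a′ → b ≈ b′ → c ≈ c′ → f ▷⟨ a , b , c ⟩ → f′ ▷⟨ a′ , b′ , c′ ⟩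
▷-resp f≈ a≈ b≈ c≈ (mk▷ a b c) = mk▷ (≈-trans (sect-cong 0 (≈-sym f≈)) (≈-trans a a≈))
  (≈-trans (sect-cong 1 (≈-sym f≈)) (≈-trans b b≈)) (≈-trans (sect-cong 2 (≈-sym f≈)) (≈-trans c c≈))

▷-K : ∀ k → K k ▷⟨ K k , K (+ 0) , K (+ 0) ⟩
▷-K k = mk▷
  (mk≈ λ { zero → sect-at 0 (K k) 0 ; (suc n) → sect-at 0 (K k) (suc n) })
  (mk≈ λ { zero → sect-at 1 (K k) 0 ; (suc n) → sect-at 1 (K k) (suc n) })
  (mk≈ λ { zero → sect-at 2 (K k) 0 ; (suc n) → sect-at 2 (K k) (suc n) })

mono-suc : ∀ e → mono (suc e) ≈ q ∙ mono e
mono-suc e = ≈-sym (q-∙ (mono e))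

▷-mono₀ : ∀ m → mono (m * 3) ▷⟨ mono m , K (+ 0) , K (+ 0) ⟩
▷-mono₀ zero    = ▷-K (+ 1)
▷-mono₀ (suc m) = ▷-resp
  (≈-trans (∙-congˡ (≈-trans (∙-congˡ (≈-sym (mono-suc (m * 3)))) (≈-sym (mono-suc (1 + m * 3)))))
      (≈-sym (mono-suc (2 + m * 3))))
  (≈-sym (mono-suc m)) q0 q0 (▷-q∙ (▷-q∙ (▷-q∙ (▷-mono₀ m))))
  where
  q0 : q ∙ K (+ 0) ≈ K (+ 0)
  q0 = solve 1 (λ q → q :* con (+ 0) := con (+ 0)) ≈-refl q

▷-mono₁ : ∀ m → mono (1 + m * 3) ▷⟨ K (+ 0) , mono m , K (+ 0) ⟩
▷-mono₁ m = ▷-resp (≈-sym (mono-suc (m * 3))) (solve 1 (λ q → q :* con (+ 0) := con (+ 0)) ≈-refl q)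
    ≈-refl ≈-refl (▷-q∙ (▷-mono₀ m))

▷-mono₂ : ∀ m → mono (2 + m * 3) ▷⟨ K (+ 0) , K (+ 0) , mono m ⟩
▷-mono₂ m = ▷-resp (≈-sym (mono-suc (1 + m * 3))) (solve 1 (λ q → q :* con (+ 0) := con (+ 0)) ≈-refl q)
    ≈-refl ≈-refl (▷-q∙ (▷-mono₁ m))

▷-unique : ∀ {f a b c a′ b′ c′} → f ▷⟨ a , b , c ⟩ → f ▷⟨ a′ , b′ , c′ ⟩ → (a ≈ a′) × (b ≈ b′) × (c ≈ c′)
▷-unique (mk▷ a b c) (mk▷ a′ b′ c′) = ≈-trans (≈-sym a) a′ , ≈-trans (≈-sym b) b′ , ≈-trans (≈-sym c) c′

-- Trisection of φ(-q) and ψ(q)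

▷-⟶ : ∀ {F f} {A B C : ℕ → PS} {a b c} → F ⟶ f → (h : ℕ → ℕ) → (∀ N → N * 3 ≤ h N) →
  (∀ N → F (h N) ▷⟨ A N , B N , C N ⟩) → A ⟶ a → B ⟶ b → C ⟶ c → f ▷⟨ a , b , c ⟩
▷-⟶ F⟶f h N*3≤h F▷ A⟶a B⟶b C⟶c = mk▷
  (⟶-unique (⟶-cong (λ N → part₀ (F▷ N)) (sect-⟶ 0 (s≤s z≤n) F⟶f h N*3≤h)) A⟶a)
  (⟶-unique (⟶-cong (λ N → part₁ (F▷ N)) (sect-⟶ 1 (s≤s (s≤s z≤n)) F⟶f h N*3≤h)) B⟶b)
  (⟶-unique (⟶-cong (λ N → part₂ (F▷ N)) (sect-⟶ 2 (s≤s (s≤s (s≤s z≤n))) F⟶f h N*3≤h)) C⟶c)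

const-⟶ : ∀ {f} → (λ _ → f) ⟶ f
const-⟶ = mk⟶ λ _ → ≈[]-refl

▷-exponent₀ : ∀ {e} m → e ≡ m * 3 → mono e ▷⟨ mono m , K (+ 0) , K (+ 0) ⟩
▷-exponent₀ m refl = ▷-mono₀ m

▷-exponent₁ : ∀ {e} m → e ≡ 1 + m * 3 → mono e ▷⟨ K (+ 0) , mono m , K (+ 0) ⟩
▷-exponent₁ m refl = ▷-mono₁ m

tri-double : ∀ m → tri (m * 2) ≡ tri m * 4 + m
tri-double zero    = refl
tri-double (suc m) = trans (cong (λ t → suc (m * 2) + (m * 2 + t)) (tri-double m)) (rearrange m (tri m))
  where
  rearrange : ∀ m t → suc (m * 2) + (m * 2 + (t * 4 + m)) ≡ (m + t) * 4 + suc m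
  rearrange = solve-∀

tri-triple : ∀ m → tri (m * 3) ≡ tri m * 9 + m * 3
tri-triple zero    = refl
tri-triple (suc m) = trans (cong (λ t → 2 + m * 3 + (1 + m * 3 + (m * 3 + t))) (tri-triple m)) (rearrange m (tri m))
  where
  rearrange : ∀ m t → 2 + m * 3 + (1 + m * 3 + (m * 3 + (t * 9 + m * 3))) ≡ (m + t) * 9 + suc m * 3
  rearrange = solve-∀

private
  zero-sum : ∀ x → x ∙ (K (+ 0) ⊞ K (+ 0)) ≈ K (+ 0)
  zero-sum = solve 1 (λ x → x :* (con (+ 0) :+ con (+ 0)) := con (+ 0)) ≈-refl

  minus-one-cubed : ∀ m → -1ℤ ℤ.^ (m * 3) ≡ -1ℤ ℤ.^ m
  minus-one-cubed zero    = refl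
  minus-one-cubed (suc m) = trans (cong (λ x → -1ℤ ℤ.* (-1ℤ ℤ.* (-1ℤ ℤ.* x))) (minus-one-cubed m)) (cube (-1ℤ ℤ.^ m))
    where
    cube : ∀ x → -1ℤ ℤ.* (-1ℤ ℤ.* (-1ℤ ℤ.* x)) ≡ -1ℤ ℤ.* x
    cube = ℤ-RingSolver.solve-∀

  -- The pair for φ(-q) of index k is 2 (-1)^k q^(k²). Squares are 0 or 1 modulo 3, so section 2 is
  -- empty, and section 0 collects the k divisible by 3.
  φ-pair₀ : ∀ m → θ-pair -1ℤ 1 1 (m * 3) ▷⟨ θ-pair -1ℤ 3 3 m , K (+ 0) , K (+ 0) ⟩
  φ-pair₀ m = ▷-resp ≈-refl (∙-congʳ (≈-reflexive (cong K (minus-one-cubed m))))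
    (zero-sum (K (-1ℤ ℤ.^ (m * 3)))) (zero-sum (K (-1ℤ ℤ.^ (m * 3))))
    (▷-K∙ (-1ℤ ℤ.^ (m * 3)) (▷-⊞ (▷-exponent₀ (6 * tri m + 3 * m) e) (▷-exponent₀ (6 * tri m + 3 * m) e)))
    where
    rearrange : ∀ m t → 2 * (t * 9 + m * 3) + 1 * (m * 3) ≡ (6 * t + 3 * m) * 3
    rearrange = solve-∀
    e : 2 * tri (m * 3) + 1 * (m * 3) ≡ (6 * tri m + 3 * m) * 3
    e = trans (cong (λ t → 2 * t + 1 * (m * 3)) (tri-triple m)) (rearrange m (tri m))

  -- Over ℤ, the classes k ≡ 1 and k ≡ 2 modulo 3 are exchanged by k ↦ -k and contribute equally:
  -- hence the 2. The minus sign is (-1)^(3m+1) = -(-1)^m.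
  φ-pair₁ : ∀ m →
      θ-pair -1ℤ 1 1 (1 + m * 3) ▷⟨ K (+ 0) , K (ℤ.- + 2) ∙ (K (-1ℤ ℤ.^ m) ∙ mono (6 * tri m + 5 * m)) , K (+ 0) ⟩
  φ-pair₁ m = ▷-resp
      ≈-refl (zero-sum s) (≈-trans (∙-congʳ (≈-trans (K-* -1ℤ _)
      (∙-congˡ (≈-reflexive (cong K (minus-one-cubed m))))))
      (solve 2 (λ s x → con -1ℤ :* s :* (x :+ x) := con (ℤ.- + 2) :* (s :* x))
          ≈-refl (K (-1ℤ ℤ.^ m)) (mono (6 * tri m + 5 * m)))) (zero-sum s)
    (▷-K∙ (-1ℤ ℤ.^ (1 + m * 3)) (▷-⊞ (▷-exponent₁ (6 * tri m + 5 * m) e) (▷-exponent₁ (6 * tri m + 5 * m) e)))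
    where
    s : PS
    s = K (-1ℤ ℤ.^ (1 + m * 3))
    rearrange : ∀ m t → 2 * (m * 3 + (t * 9 + m * 3)) + 1 * (1 + m * 3) ≡ 1 + (6 * t + 5 * m) * 3
    rearrange = solve-∀
    e : 2 * tri (1 + m * 3) + 1 * (1 + m * 3) ≡ 1 + (6 * tri m + 5 * m) * 3
    e = trans (cong (λ t → 2 * (m * 3 + t) + 1 * (1 + m * 3)) (tri-triple m)) (rearrange m (tri m))

  φ-pair₂ : ∀ m →
      θ-pair -1ℤ 1 1 (2 + m * 3) ▷⟨ K (+ 0) , K (ℤ.- + 2) ∙ (K (-1ℤ ℤ.^ suc m) ∙ mono (6 * tri (suc m) + 1 * suc m)) , K (+ 0) ⟩
  φ-pair₂ m = ▷-resp ≈-refl (zero-sum s) (≈-trans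
      (∙-congʳ (≈-trans (≈-trans (K-* -1ℤ _) (∙-congˡ (K-* -1ℤ _))) (∙-congˡ
          (∙-congˡ (≈-reflexive (cong K (minus-one-cubed m)))))))
      (≈-trans (solve 2 (λ s x → con -1ℤ :* (con -1ℤ :* s) :* (x :+ x) := con (ℤ.- + 2) :* (con -1ℤ :* s :* x))
          ≈-refl (K (-1ℤ ℤ.^ m)) (mono (6 * tri (suc m) + 1 * suc m)))
        (∙-congˡ (∙-congʳ (≈-sym (K-* -1ℤ _)))))) (zero-sum s)
    (▷-K∙ (-1ℤ ℤ.^ (2 + m * 3)) (▷-⊞ (▷-exponent₁ (6 * tri (suc m) + 1 * suc m) e)
        (▷-exponent₁ (6 * tri (suc m) + 1 * suc m) e)))
    where
    s : PS
    s = K (-1ℤ ℤ.^ (2 + m * 3))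
    rearrange : ∀ m t →
        2 * (1 + m * 3 + (m * 3 + (t * 9 + m * 3))) + 1 * (2 + m * 3) ≡ 1 + (6 * (m + t) + 1 * (1 + m)) * 3
    rearrange = solve-∀
    e : 2 * tri (2 + m * 3) + 1 * (2 + m * 3) ≡ 1 + (6 * tri (suc m) + 1 * suc m) * 3
    e = trans (cong (λ t → 2 * (1 + m * 3 + (m * 3 + t)) + 1 * (2 + m * 3)) (tri-triple m)) (rearrange m (tri m))

  -- The cut after 1 + 3N is where the second section consists of complete pairs: index 3N - 1
  -- supplies one half of its pair N and index 3N + 1 the other.
  φ-sum : ∀ N →
      ∑ (1 + N * 3) (θ-term -1ℤ 1 1) ▷⟨ ∑ N (θ-term -1ℤ 3 3) , K (ℤ.- + 2) ∙ ∑ N (θ-term -1ℤ 5 1) , K (+ 0) ⟩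
  φ-sum zero = ▷-resp ≈-refl
    (solve 0 (con (+ 1) :+ con (+ 0) := con (+ 1)) ≈-refl)
    (solve 0 (con (+ 0) :+ con (ℤ.- + 2) :* (con (+ 1) :* con (+ 1)) := con (ℤ.- + 2) :* con (+ 1)) ≈-refl)
    (solve 0 (con (+ 0) :+ con (+ 0) := con (+ 0)) ≈-refl)
    (▷-⊞ (▷-K (+ 1)) (φ-pair₁ 0))
  φ-sum (suc N) = ▷-resp ≈-refl
    (solve 2 (λ a b → a :+ con (+ 0) :+ b :+ con (+ 0) := a :+ b)
        ≈-refl (∑ N (θ-term -1ℤ 3 3)) (θ-pair -1ℤ 3 3 (suc N)))
    (solve 4 (λ a s x y → con (ℤ.- + 2) :* a :+ con (ℤ.- + 2) :* (s :* x) :+ con (+ 0) :+ con (ℤ.- + 2) :* (s :* y) :=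
                          con (ℤ.- + 2) :* (a :+ s :* (y :+ x))) ≈-refl
      (∑ N (θ-term -1ℤ 5 1)) (K (-1ℤ ℤ.^ suc N)) (mono (6 * tri (suc N) + 1 * suc N)) (mono (6 * tri (suc N) + 5 * suc N)))
    (solve 0 (con (+ 0) :+ con (+ 0) :+ con (+ 0) :+ con (+ 0) := con (+ 0)) ≈-refl)
    (▷-⊞ (▷-⊞ (▷-⊞ (φ-sum N) (φ-pair₂ N)) (φ-pair₀ (suc N))) (φ-pair₁ (suc N)))

φ-trisection : poch± -1ℤ 2 2 ∙ (poch± -1ℤ 1 2 ∙ poch± -1ℤ 1 2) ▷⟨
  poch± -1ℤ 6 6 ∙ (poch± -1ℤ 3 6 ∙ poch± -1ℤ 3 6) ,
  K (ℤ.- + 2) ∙ (poch± -1ℤ 6 6 ∙ (poch± -1ℤ 5 6 ∙ poch± -1ℤ 1 6)) ,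
  K (+ 0) ⟩
φ-trisection = ▷-⟶ (jacobi-triple-product -1ℤ refl 0 0) (λ N → 1 + N * 3) (λ N → ℕ.n≤1+n _) φ-sum
  (jacobi-triple-product -1ℤ refl 2 2) (⟶-∙ const-⟶ (jacobi-triple-product -1ℤ refl 4 0)) const-⟶

private
  pair-unsigned : ∀ a b k → mono ((a + b) * tri k + a * k) ⊞ mono ((a + b) * tri k + b * k) ≈ θ-pair (+ 1) a b k
  pair-unsigned a b k = ≈-trans (≈-sym (K-1-∙ _)) (∙-congʳ (≈-reflexive (cong K (sym (ℤ.^-zeroˡ k)))))

  -- The pair of index k for ψ(q) has exponents 2k² - k and 2k² + k, both triangular numbers. For k
  -- = 3m both are divisible by 3 and give the pair of index 2m in the series of generalized
  -- pentagonal numbers.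
  ψ-pair₀ : ∀ m → θ-pair (+ 1) 1 3 (m * 3) ▷⟨ θ-pair (+ 1) 1 2 (m * 2) , K (+ 0) , K (+ 0) ⟩
  ψ-pair₀ m = ▷-resp (pair-unsigned 1 3 (m * 3)) (pair-unsigned 1 2 (m * 2))
    (solve 0 (con (+ 0) :+ con (+ 0) := con (+ 0)) ≈-refl) (solve 0 (con (+ 0) :+ con (+ 0) := con (+ 0)) ≈-refl)
    (▷-⊞ (▷-exponent₀ (3 * tri (m * 2) + 1 * (m * 2)) e₁) (▷-exponent₀ (3 * tri (m * 2) + 2 * (m * 2)) e₂))
    where
    rearrange₁ : ∀ m t → 4 * (t * 9 + m * 3) + 1 * (m * 3) ≡ (3 * (t * 4 + m) + 1 * (m * 2)) * 3
    rearrange₁ = solve-∀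
    rearrange₂ : ∀ m t → 4 * (t * 9 + m * 3) + 3 * (m * 3) ≡ (3 * (t * 4 + m) + 2 * (m * 2)) * 3
    rearrange₂ = solve-∀
    e₁ : 4 * tri (m * 3) + 1 * (m * 3) ≡ (3 * tri (m * 2) + 1 * (m * 2)) * 3
    e₁ rewrite tri-triple m | tri-double m = rearrange₁ m (tri m)
    e₂ : 4 * tri (m * 3) + 3 * (m * 3) ≡ (3 * tri (m * 2) + 2 * (m * 2)) * 3
    e₂ rewrite tri-triple m | tri-double m = rearrange₂ m (tri m)

  -- Here the pair is torn apart: one exponent is 1 modulo 3, the other 0. The odd pair of index 2m
  -- + 1 in section 0 receives one half from k = 3m + 1 and the other from k = 3m + 2.
  ψ-pair₁ : ∀ m →
      θ-pair (+ 1) 1 3 (1 + m * 3) ▷⟨ mono (3 * tri (1 + m * 2) + 1 * (1 + m * 2)) , mono (12 * tri m + 9 * m) , K (+ 0) ⟩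
  ψ-pair₁ m = ▷-resp (pair-unsigned 1 3 (1 + m * 3))
    (solve 1 (λ x → con (+ 0) :+ x := x) ≈-refl (mono (3 * tri (1 + m * 2) + 1 * (1 + m * 2))))
    (solve 1 (λ x → x :+ con (+ 0) := x) ≈-refl (mono (12 * tri m + 9 * m)))
    (solve 0 (con (+ 0) :+ con (+ 0) := con (+ 0)) ≈-refl)
    (▷-⊞ (▷-exponent₁ (12 * tri m + 9 * m) e₁) (▷-exponent₀ (3 * tri (1 + m * 2) + 1 * (1 + m * 2)) e₂))
    where
    rearrange₁ : ∀ m t → 4 * (m * 3 + (t * 9 + m * 3)) + 1 * (1 + m * 3) ≡ 1 + (12 * t + 9 * m) * 3
    rearrange₁ = solve-∀
    rearrange₂ : ∀ m t →
        4 * (m * 3 + (t * 9 + m * 3)) + 3 * (1 + m * 3) ≡ (3 * (m * 2 + (t * 4 + m)) + 1 * (1 + m * 2)) * 3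
    rearrange₂ = solve-∀
    e₁ : 4 * tri (1 + m * 3) + 1 * (1 + m * 3) ≡ 1 + (12 * tri m + 9 * m) * 3
    e₁ rewrite tri-triple m = rearrange₁ m (tri m)
    e₂ : 4 * tri (1 + m * 3) + 3 * (1 + m * 3) ≡ (3 * tri (1 + m * 2) + 1 * (1 + m * 2)) * 3
    e₂ rewrite tri-triple m | tri-double m = rearrange₂ m (tri m)

  ψ-pair₂ : ∀ m →
      θ-pair (+ 1) 1 3 (2 + m * 3) ▷⟨ mono (3 * tri (1 + m * 2) + 2 * (1 + m * 2)) , mono (12 * tri (suc m) + 3 * suc m) , K (+ 0) ⟩
  ψ-pair₂ m = ▷-resp (pair-unsigned 1 3 (2 + m * 3))
    (solve 1 (λ x → x :+ con (+ 0) := x) ≈-refl (mono (3 * tri (1 + m * 2) + 2 * (1 + m * 2))))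
    (solve 1 (λ x → con (+ 0) :+ x := x) ≈-refl (mono (12 * tri (suc m) + 3 * suc m)))
    (solve 0 (con (+ 0) :+ con (+ 0) := con (+ 0)) ≈-refl)
    (▷-⊞ (▷-exponent₀ (3 * tri (1 + m * 2) + 2 * (1 + m * 2)) e₁) (▷-exponent₁ (12 * tri (suc m) + 3 * suc m) e₂))
    where
    rearrange₁ : ∀ m t →
        4 * (1 + m * 3 + (m * 3 + (t * 9 + m * 3))) + 1 * (2 + m * 3) ≡ (3 * (m * 2 + (t * 4 + m)) + 2 * (1 + m * 2)) * 3
    rearrange₁ = solve-∀
    rearrange₂ : ∀ m t →
        4 * (1 + m * 3 + (m * 3 + (t * 9 + m * 3))) + 3 * (2 + m * 3) ≡ 1 + (12 * (m + t) + 3 * (1 + m)) * 3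
    rearrange₂ = solve-∀
    e₁ : 4 * tri (2 + m * 3) + 1 * (2 + m * 3) ≡ (3 * tri (1 + m * 2) + 2 * (1 + m * 2)) * 3
    e₁ rewrite tri-triple m | tri-double m = rearrange₁ m (tri m)
    e₂ : 4 * tri (2 + m * 3) + 3 * (2 + m * 3) ≡ 1 + (12 * tri (suc m) + 3 * suc m) * 3
    e₂ rewrite tri-triple m = rearrange₂ m (tri m)

  -- The first section of the partial sum stops in the middle of the pair of index 1 + 2 N.
  ψ-sum₀ : ℕ → PS
  ψ-sum₀ N = ∑ (N * 2) (θ-term (+ 1) 1 2) ⊞ mono (3 * tri (1 + N * 2) + 1 * (1 + N * 2))

  ψ-sum : ∀ N → ∑ (1 + N * 3) (θ-term (+ 1) 1 3) ▷⟨ ψ-sum₀ N , ∑ N (θ-term (+ 1) 3 9) , K (+ 0) ⟩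
  ψ-sum zero = ▷-resp ≈-refl ≈-refl
    (solve 0 (con (+ 0) :+ con (+ 1) := con (+ 1)) ≈-refl)
    (solve 0 (con (+ 0) :+ con (+ 0) := con (+ 0)) ≈-refl)
    (▷-⊞ (▷-K (+ 1)) (ψ-pair₁ 0))
  ψ-sum (suc N) = ▷-resp ≈-refl
    (⊞-congʳ (⊞-congʳ (≈-trans
      (solve 3 (λ S x y → S :+ x :+ y := S :+ (x :+ y))
          ≈-refl (∑ (N * 2) (θ-term (+ 1) 1 2)) (mono (3 * tri (1 + N * 2) + 1 * (1 + N * 2))) (mono (3 * tri (1 + N * 2) + 2 * (1 + N * 2))))
      (⊞-congˡ (pair-unsigned 1 2 (1 + N * 2))))))
    (≈-trans
      (solve 3 (λ S x y → S :+ x :+ con (+ 0) :+ y := S :+ (x :+ y))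
          ≈-refl (∑ N (θ-term (+ 1) 3 9)) (mono (12 * tri (suc N) + 3 * suc N)) (mono (12 * tri (suc N) + 9 * suc N)))
      (⊞-congˡ (pair-unsigned 3 9 (suc N))))
    (solve 0 (con (+ 0) :+ con (+ 0) :+ con (+ 0) :+ con (+ 0) := con (+ 0)) ≈-refl)
    (▷-⊞ (▷-⊞ (▷-⊞ (ψ-sum N) (ψ-pair₂ N)) (ψ-pair₀ (suc N))) (ψ-pair₁ (suc N)))

  -- The unpaired monomial has exponent at least 1 + 2N, so it is invisible modulo q^N.
  ψ-sum₀-⟶ : ψ-sum₀ ⟶ poch± -1ℤ 3 3 ∙ (poch± (+ 1) 1 3 ∙ poch± (+ 1) 2 3)
  ψ-sum₀-⟶ = ⟶-resp
    (λ N → ≈[]-trans (≈⇒≈[] (solve 1 (λ x → x := x :+ con (+ 0)) ≈-refl _))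
      (⊞-cong[] ≈[]-refl (≈[]-sym (mono-≈[] (ℕ.≤-trans (ℕ.m≤m*n N 2) (ℕ.≤-trans (ℕ.n≤1+n _) (ℕ.≤-trans (ℕ.m≤n*m _ 1)
          (ℕ.m≤n+m _ (3 * tri (1 + N * 2))))))))))
    (⟶-subsequence (_* 2) (λ N → ℕ.m≤m*n N 2) (jacobi-triple-product (+ 1) refl 0 1))

ψ-trisection : poch± -1ℤ 4 4 ∙ (poch± (+ 1) 1 4 ∙ poch± (+ 1) 3 4) ▷⟨
  poch± -1ℤ 3 3 ∙ (poch± (+ 1) 1 3 ∙ poch± (+ 1) 2 3) ,
  poch± -1ℤ 12 12 ∙ (poch± (+ 1) 3 12 ∙ poch± (+ 1) 9 12) ,
  K (+ 0) ⟩
ψ-trisection = ▷-⟶ (jacobi-triple-product (+ 1) refl 0 2) (λ N → 1 + N * 3) (λ N → ℕ.n≤1+n _) ψ-sum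
  ψ-sum₀-⟶ (jacobi-triple-product (+ 1) refl 2 8) const-⟶

-- Product evaluations of the theta series and of their sections

-- (q^a; q^d)_∞ and (-q^a; q^d)_∞.
Π⁻ Π⁺ : ℕ → ℕ → PS
Π⁻ = poch± -1ℤ
Π⁺ = poch± (+ 1)

∏-constant : ∀ n F → (∀ j → F j ≈[ 1 ] K (+ 1)) → ∏ n F ≈[ 1 ] K (+ 1)
∏-constant zero    F F≈1 = ≈[]-refl
∏-constant (suc n) F F≈1 = ≈[]-trans (K-1-∙[] (F≈1 n)) (∏-constant n F F≈1)

poch±-constant : ∀ σ a d → poch± σ (suc a) d 0 ≡ + 1
poch±-constant σ a d = below (∏-constant 1 (λ j → fac σ (suc a + d * j)) λ j → fac-≈[] σ {suc a + d * j} (s≤s z≤n)) (s≤s z≤n)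

∙-constant : ∀ f g → f 0 ≡ + 1 → g 0 ≡ + 1 → (f ∙ g) 0 ≡ + 1
∙-constant f g f₀≡1 g₀≡1 = trans (∙-zero f g) (cong₂ ℤ._*_ f₀≡1 g₀≡1)

f₁≈ : Π⁻ 1 1 ≈ Π⁻ 1 2 ∙ Π⁻ 2 2
f₁≈ = ≈-sym (poch±-split₂ _ 0 0)

f₃≈ : Π⁻ 3 3 ≈ Π⁻ 3 6 ∙ Π⁻ 6 6
f₃≈ = ≈-sym (poch±-split₂ _ 2 2)

φ-part₁ : Π⁻ 6 6 ∙ (Π⁻ 5 6 ∙ Π⁻ 1 6) ∙ Π⁻ 3 6 ≈ Π⁻ 1 2 ∙ Π⁻ 6 6
φ-part₁ = begin
  Π⁻ 6 6 ∙ (Π⁻ 5 6 ∙ Π⁻ 1 6) ∙ Π⁻ 3 6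
    ≈⟨ solve 4 (λ a b c d → a :* (b :* c) :* d := c :* d :* b :* a) ≈-refl (Π⁻ 6 6) (Π⁻ 5 6) (Π⁻ 1 6) (Π⁻ 3 6) ⟩
  Π⁻ 1 6 ∙ Π⁻ 3 6 ∙ Π⁻ 5 6 ∙ Π⁻ 6 6
    ≈⟨ ∙-congʳ (poch±-split₃ _ 0 1) ⟩
  Π⁻ 1 2 ∙ Π⁻ 6 6 ∎

ψ-product : Π⁻ 4 4 ∙ (Π⁺ 1 4 ∙ Π⁺ 3 4) ∙ Π⁻ 1 2 ≈ Π⁻ 2 2
ψ-product = begin
  Π⁻ 4 4 ∙ (Π⁺ 1 4 ∙ Π⁺ 3 4) ∙ Π⁻ 1 2
    ≈⟨ ∙-congʳ (∙-congˡ (poch±-split₂ _ 0 1)) ⟩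
  Π⁻ 4 4 ∙ Π⁺ 1 2 ∙ Π⁻ 1 2
    ≈⟨ solve 3 (λ a b c → a :* b :* c := c :* b :* a) ≈-refl (Π⁻ 4 4) (Π⁺ 1 2) (Π⁻ 1 2) ⟩
  Π⁻ 1 2 ∙ Π⁺ 1 2 ∙ Π⁻ 4 4
    ≈⟨ ∙-congʳ (poch±-conjugate 0 1) ⟩
  Π⁻ 2 4 ∙ Π⁻ 4 4
    ≈⟨ poch±-split₂ _ 1 1 ⟩
  Π⁻ 2 2 ∎

ψ-part₁ : Π⁻ 12 12 ∙ (Π⁺ 3 12 ∙ Π⁺ 9 12) ∙ Π⁻ 3 6 ≈ Π⁻ 6 6
ψ-part₁ = begin
  Π⁻ 12 12 ∙ (Π⁺ 3 12 ∙ Π⁺ 9 12) ∙ Π⁻ 3 6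
    ≈⟨ ∙-congʳ (∙-congˡ (poch±-split₂ _ 2 5)) ⟩
  Π⁻ 12 12 ∙ Π⁺ 3 6 ∙ Π⁻ 3 6
    ≈⟨ solve 3 (λ a b c → a :* b :* c := c :* b :* a) ≈-refl (Π⁻ 12 12) (Π⁺ 3 6) (Π⁻ 3 6) ⟩
  Π⁻ 3 6 ∙ Π⁺ 3 6 ∙ Π⁻ 12 12
    ≈⟨ ∙-congʳ (poch±-conjugate 2 5) ⟩
  Π⁻ 6 12 ∙ Π⁻ 12 12
    ≈⟨ poch±-split₂ _ 5 5 ⟩
  Π⁻ 6 6 ∎

-- The residue class 3 is missing from (-q; q)_∞. Multiplying by f₆ = f₃ (-q³; q³)_∞ supplies it,
-- and multiplying by f₂ turns (q; q²)_∞ into f₁; then f₁ (-q; q)_∞ = f₂, and f₆ f₂ cancels.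
ψ-part₀ : Π⁻ 3 3 ∙ (Π⁺ 1 3 ∙ Π⁺ 2 3) ∙ Π⁻ 1 2 ≈ Π⁻ 3 6 ∙ Π⁻ 3 6 ∙ Π⁻ 6 6
ψ-part₀ = ∙-cancelˡ (∙-constant (Π⁻ 6 6) (Π⁻ 2 2) (poch±-constant _ 5 6) (poch±-constant _ 1 2)) (begin
  f₆ ∙ f₂ ∙ (f₃ ∙ (m₁ ∙ m₂) ∙ x)
    ≈⟨ ∙-congʳ (∙-congʳ (poch±-conjugate 2 2)) ⟨
  f₃ ∙ m₃ ∙ f₂ ∙ (f₃ ∙ (m₁ ∙ m₂) ∙ x)
    ≈⟨ solve 6 (λ f₃ m₃ f₂ m₁ m₂ x → f₃ :* m₃ :* f₂ :* (f₃ :* (m₁ :* m₂) :* x) :=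
        f₃ :* f₃ :* (x :* f₂ :* (m₁ :* m₂ :* m₃))) ≈-refl f₃ m₃ f₂ m₁ m₂ x ⟩
  f₃ ∙ f₃ ∙ (x ∙ f₂ ∙ (m₁ ∙ m₂ ∙ m₃))
    ≈⟨ ∙-congˡ (∙-cong (poch±-split₂ _ 0 0) (poch±-split₃ _ 0 0)) ⟩
  f₃ ∙ f₃ ∙ (Π⁻ 1 1 ∙ Π⁺ 1 1)
    ≈⟨ ∙-cong (∙-cong f₃≈ f₃≈) (poch±-conjugate 0 0) ⟩
  y ∙ f₆ ∙ (y ∙ f₆) ∙ f₂
    ≈⟨ solve 3 (λ y f₆ f₂ → y :* f₆ :* (y :* f₆) :* f₂ := f₆ :* f₂ :* (y :* y :* f₆)) ≈-refl y f₆ f₂ ⟩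
  f₆ ∙ f₂ ∙ (y ∙ y ∙ f₆) ∎)
  where
  f₂ f₃ f₆ x y m₁ m₂ m₃ : PS
  f₂ = Π⁻ 2 2
  f₃ = Π⁻ 3 3
  f₆ = Π⁻ 6 6
  x = Π⁻ 1 2
  y = Π⁻ 3 6
  m₁ = Π⁺ 1 3
  m₂ = Π⁺ 2 3
  m₃ = Π⁺ 3 3

-- Norms

-- With f = a(q³) + q b(q³) + q² c(q³), norm a b c is f(q) f(ωq) f(ω²q) after
-- q³ ↦ q, for ω a primitive cube root of unity.
norm : PS → PS → PS → PS
norm a b c = a ∙ a ∙ a ⊞ q ∙ (b ∙ b ∙ b) ⊞ q ∙ q ∙ (c ∙ c ∙ c) ⊞ ⊟ (K (+ 3) ∙ q ∙ a ∙ b ∙ c)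

norm-cong : ∀ {a a′ b b′ c c′} → a ≈ a′ → b ≈ b′ → c ≈ c′ → norm a b c ≈ norm a′ b′ c′
norm-cong p r s = ⊞-cong (⊞-cong (⊞-cong (∙-cong (∙-cong p p) p) (∙-congˡ (∙-cong (∙-cong r r) r))) (∙-congˡ (∙-cong
    (∙-cong s s) s)))
  (⊟-cong (∙-cong (∙-cong (∙-congˡ p) r) s))

norm-⟶ : ∀ {A B C : ℕ → PS} {a b c} → A ⟶ a → B ⟶ b → C ⟶ c → (λ N → norm (A N) (B N) (C N)) ⟶ norm a b c
norm-⟶ A⟶a B⟶b C⟶c = mk⟶ λ N → let p = upTo A⟶a N; r = upTo B⟶b N; s = upTo C⟶c N in
  ⊞-cong[] (⊞-cong[] (⊞-cong[] (∙-cong[] (∙-cong[] p p) p) (∙-cong[] ≈[]-refl (∙-cong[] (∙-cong[] r r) r)))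
      (∙-cong[] ≈[]-refl (∙-cong[] (∙-cong[] s s) s)))
    (⊟-cong[] (∙-cong[] (∙-cong[] (∙-cong[] ≈[]-refl p) r) s))

-- `norm a b c` is the determinant of multiplication by f on triples of sections, a circulant up to
-- powers of q; its multiplicativity is an identity of polynomials in q and the six sections.
norm-product : ∀ a b c a′ b′ c′ →
  norm (product₀ a b c a′ b′ c′) (product₁ a b c a′ b′ c′) (product₂ a b c a′ b′ c′) ≈ norm a b c ∙ norm a′ b′ c′
norm-product = solve 7 (λ q a b c a′ b′ c′ →
  :norm q (a :* a′ :+ q :* (b :* c′ :+ c :* b′)) (a :* b′ :+ b :* a′ :+ q :* (c :* c′)) (a :* c′ :+ b :* b′ :+ c :* a′) :=
  :norm q a b c :* :norm q a′ b′ c′) ≈-refl q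
  where
  :norm = λ q a b c → a :* a :* a :+ q :* (b :* b :* b) :+ q :* q :* (c :* c :* c) :+ :- (con (+ 3) :* q :* a :* b :* c)

Norm : PS → PS
Norm f = norm (sect 0 f) (sect 1 f) (sect 2 f)

Norm-▷ : ∀ {f a b c} → f ▷⟨ a , b , c ⟩ → Norm f ≈ norm a b c
Norm-▷ (mk▷ a b c) = norm-cong a b c

Norm-cong : ∀ {f g} → f ≈ g → Norm f ≈ Norm g
Norm-cong f≈g = norm-cong (sect-cong 0 f≈g) (sect-cong 1 f≈g) (sect-cong 2 f≈g)

Norm-∙ : ∀ f g → Norm (f ∙ g) ≈ Norm f ∙ Norm g
Norm-∙ f g = ≈-trans (Norm-▷ (▷-∙ (mk▷ ≈-refl ≈-refl ≈-refl) (mk▷ ≈-refl ≈-refl ≈-refl))) (norm-product _ _ _ _ _ _)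

Norm-∏ : ∀ n F → Norm (∏ n F) ≈ ∏ n (λ j → Norm (F j))
Norm-∏ zero    F = ≈-trans (Norm-▷ (▷-K (+ 1)))
  (solve 1 (λ q → con (+ 1) :* con (+ 1) :* con (+ 1) :+ q :* (con (+ 0) :* con (+ 0) :* con (+ 0)) :+ q :* q :* (con (+ 0) :* con (+ 0) :* con (+ 0))
    :+ :- (con (+ 3) :* q :* con (+ 1) :* con (+ 0) :* con (+ 0)) := con (+ 1)) ≈-refl q)
Norm-∏ (suc n) F = ≈-trans (Norm-∙ (∏ n F) (F n)) (∙-congʳ (Norm-∏ n F))

-- Coefficients of a section below N are coefficients of the series below 3N, hence the index N * 3.
Norm-⟶ : ∀ {F f} → F ⟶ f → (λ N → Norm (F (N * 3))) ⟶ Norm f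
Norm-⟶ F⟶f = norm-⟶
  (sect-⟶ 0 (s≤s z≤n) F⟶f (_* 3) (λ _ → ℕ.≤-refl))
  (sect-⟶ 1 (s≤s (s≤s z≤n)) F⟶f (_* 3) (λ _ → ℕ.≤-refl))
  (sect-⟶ 2 (s≤s (s≤s (s≤s z≤n))) F⟶f (_* 3) (λ _ → ℕ.≤-refl))

private
  mono-cube : ∀ m → mono m ∙ mono m ∙ mono m ≈ mono (m * 3)
  mono-cube m = ≈-trans (∙-congʳ (≈-sym (mono-+ m m))) (≈-trans (≈-sym (mono-+ (m + m) m)) (mono-cong (triple m)))
    where
    triple : ∀ m → m + m + m ≡ m * 3
    triple = solve-∀

Norm-fac₀ : ∀ m → Norm (fac -1ℤ (m * 3)) ≈ fac -1ℤ m ∙ fac -1ℤ m ∙ fac -1ℤ m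
Norm-fac₀ m = ≈-trans (Norm-▷ (▷-⊞ (▷-K (+ 1)) (▷-K∙ -1ℤ (▷-mono₀ m))))
  (solve 2 (λ q x → let z = con (+ 0) :+ con -1ℤ :* con (+ 0); a = con (+ 1) :+ con -1ℤ :* x in
    a :* a :* a :+ q :* (z :* z :* z) :+ q :* q :* (z :* z :* z) :+ :- (con (+ 3) :* q :* a :* z :* z) :=
        a :* a :* a) ≈-refl q (mono m))

-- For 3 ∤ e the conjugates of 1 - q^e multiply to 1 - q^(3e), which q³ ↦ q takes back to 1 - q^e.
Norm-fac₁ : ∀ m {e} → e ≡ 1 + m * 3 → Norm (fac -1ℤ e) ≈ fac -1ℤ e
Norm-fac₁ m refl = ≈-trans (Norm-▷ (▷-⊞ (▷-K (+ 1)) (▷-K∙ -1ℤ (▷-mono₁ m)))) (≈-trans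
  (solve 2 (λ q x → let z = con (+ 0) :+ con -1ℤ :* con (+ 0); a = con (+ 1) :+ con -1ℤ :* con (+ 0); b = con (+ 0) :+ con -1ℤ :* x in
    a :* a :* a :+ q :* (b :* b :* b) :+ q :* q :* (z :* z :* z) :+ :- (con (+ 3) :* q :* a :* b :* z) :=
        con (+ 1) :+ con -1ℤ :* (q :* (x :* x :* x))) ≈-refl q (mono m))
  (⊞-congˡ (∙-congˡ (≈-trans (∙-congˡ (mono-cube m)) (≈-sym (mono-suc (m * 3)))))))

Norm-fac₂ : ∀ m {e} → e ≡ 2 + m * 3 → Norm (fac -1ℤ e) ≈ fac -1ℤ e
Norm-fac₂ m refl = ≈-trans (Norm-▷ (▷-⊞ (▷-K (+ 1)) (▷-K∙ -1ℤ (▷-mono₂ m)))) (≈-trans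
  (solve 2 (λ q x → let z = con (+ 0) :+ con -1ℤ :* con (+ 0); a = con (+ 1) :+ con -1ℤ :* con (+ 0); c = con (+ 0) :+ con -1ℤ :* x in
    a :* a :* a :+ q :* (z :* z :* z) :+ q :* q :* (c :* c :* c) :+ :- (con (+ 3) :* q :* a :* z :* c) :=
        con (+ 1) :+ con -1ℤ :* (q :* (q :* (x :* x :* x)))) ≈-refl q (mono m))
  (⊞-congˡ (∙-congˡ (≈-trans (∙-congˡ (≈-trans (∙-congˡ (mono-cube m)) (≈-sym (mono-suc (m * 3)))))
      (≈-sym (mono-suc (1 + m * 3)))))))

-- The factors of index 2 + 3j have exponent 3 κ (j + 1) and contribute the cube of the whole
-- product. The others are fixed when 3 ∤ κ, which the two hypotheses express; they make up the
-- product with its class 2 removed, whence the factor in q^(3κ) on the left.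
Norm-euler : ∀ k → let κ = suc k in
  (∀ j → Norm (fac -1ℤ (κ + κ * (j * 3))) ≈ fac -1ℤ (κ + κ * (j * 3))) →
  (∀ j → Norm (fac -1ℤ (κ + κ * (1 + j * 3))) ≈ fac -1ℤ (κ + κ * (1 + j * 3))) →
  Norm (Π⁻ κ κ) ∙ Π⁻ (κ * 3) (κ * 3) ≈ Π⁻ κ κ ∙ (Π⁻ κ κ ∙ Π⁻ κ κ ∙ Π⁻ κ κ)
Norm-euler k class₀ class₁ = ⟶-unique
  (⟶-∙ (Norm-⟶ (poch±-⟶ -1ℤ k k)) (poch±-⟶ -1ℤ (2 + k * 3) (2 + k * 3)))
  (⟶-cong finite (⟶-∙ (⟶-subsequence (_* 3) (λ N → ℕ.m≤m*n N 3) (poch±-⟶ -1ℤ k k))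
    (⟶-∙ (⟶-∙ (poch±-⟶ -1ℤ k k) (poch±-⟶ -1ℤ k k)) (poch±-⟶ -1ℤ k k))))
  where
  κ : ℕ
  κ = suc k
  F : ℕ → PS
  F j = fac -1ℤ (κ + κ * j)
  exponent : ∀ κ j → κ + κ * (2 + j * 3) ≡ (κ + κ * j) * 3
  exponent = solve-∀
  exponent′ : ∀ κ j → κ * 3 + κ * 3 * j ≡ κ + κ * (2 + j * 3)
  exponent′ = solve-∀
  class₂ : ∀ j → Norm (F (2 + j * 3)) ≈ F j ∙ F j ∙ F j
  class₂ j = ≈-trans (Norm-cong (fac-cong -1ℤ (exponent κ j))) (Norm-fac₀ (κ + κ * j))
  finite : ∀ N → ∏ (N * 3) F ∙ (∏ N F ∙ ∏ N F ∙ ∏ N F) ≈ Norm (∏ (N * 3) F) ∙ ∏ N (λ j → fac -1ℤ (κ * 3 + κ * 3 * j))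
  finite N = begin
    ∏ (N * 3) F ∙ (∏ N F ∙ ∏ N F ∙ ∏ N F)
      ≈⟨ ∙-congʳ (∏-split₃ N F) ⟩
    A ∙ B ∙ C ∙ (∏ N F ∙ ∏ N F ∙ ∏ N F)
      ≈⟨ solve 4 (λ a b c d → a :* b :* c :* d := a :* b :* d :* c) ≈-refl A B C (∏ N F ∙ ∏ N F ∙ ∏ N F) ⟩
    A ∙ B ∙ (∏ N F ∙ ∏ N F ∙ ∏ N F) ∙ C
      ≈⟨ ∙-cong (∙-cong (∙-cong (∏-cong N class₀) (∏-cong N class₁))
           (≈-trans (∏-cong N class₂) (≈-trans (∏-∙ N _ _) (∙-congʳ (∏-∙ N _ _)))))
           (∏-cong N (λ j → fac-cong -1ℤ (exponent′ κ j))) ⟨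
    ∏ N (λ j → Norm (F (j * 3))) ∙ ∏ N (λ j → Norm (F (1 + j * 3))) ∙ ∏ N (λ j → Norm (F (2 + j * 3)))
      ∙ ∏ N (λ j → fac -1ℤ (κ * 3 + κ * 3 * j))
      ≈⟨ ∙-congʳ (≈-trans (Norm-∏ (N * 3) F) (∏-split₃ N (λ j → Norm (F j)))) ⟨
    Norm (∏ (N * 3) F) ∙ ∏ N (λ j → fac -1ℤ (κ * 3 + κ * 3 * j)) ∎
    where
    A B C : PS
    A = ∏ N (λ j → F (j * 3))
    B = ∏ N (λ j → F (1 + j * 3))
    C = ∏ N (λ j → F (2 + j * 3))

Norm-f₁ : Norm (Π⁻ 1 1) ∙ (Π⁻ 3 3) ≈ (Π⁻ 1 1) ∙ ((Π⁻ 1 1) ∙ (Π⁻ 1 1) ∙ (Π⁻ 1 1))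
Norm-f₁ = Norm-euler 0 (λ j → Norm-fac₁ j (e₀ j)) (λ j → Norm-fac₂ j (e₁ j))
  where
  e₀ : ∀ j → 1 + 1 * (j * 3) ≡ 1 + j * 3
  e₀ = solve-∀
  e₁ : ∀ j → 1 + 1 * (1 + j * 3) ≡ 2 + j * 3
  e₁ = solve-∀

Norm-f₂ : Norm (Π⁻ 2 2) ∙ (Π⁻ 6 6) ≈ (Π⁻ 2 2) ∙ ((Π⁻ 2 2) ∙ (Π⁻ 2 2) ∙ (Π⁻ 2 2))
Norm-f₂ = Norm-euler 1 (λ j → Norm-fac₂ (j * 2) (e₀ j)) (λ j → Norm-fac₁ (1 + j * 2) (e₁ j))
  where
  e₀ : ∀ j → 2 + 2 * (j * 3) ≡ 2 + (j * 2) * 3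
  e₀ = solve-∀
  e₁ : ∀ j → 2 + 2 * (1 + j * 3) ≡ 1 + (1 + j * 2) * 3
  e₁ = solve-∀

-- The generating function of PD

G : ℕ → PS
G k n = + PDb k n

multiples : ℕ → ℕ → PS
multiples t M = ∑ M (λ m → K (+ m) ∙ mono (m * t))

mono-∙-at : ∀ e g n → (mono e ∙ g) n ≡ (if e ≤ᵇ n then g (n ∸ e) else + 0)
mono-∙-at zero    g n       = at (K-1-∙ g) n
mono-∙-at (suc e) g zero    = at (qShift-∙ (mono e) g) 0
mono-∙-at (suc e) g (suc n) = trans (at (qShift-∙ (mono e) g) (suc n)) (trans (mono-∙-at e g n) (shift e))
  where
  shift : ∀ e → (if e ≤ᵇ n then g (n ∸ e) else + 0) ≡ (if suc e ≤ᵇ suc n then g (n ∸ e) else + 0)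
  shift zero    = refl
  shift (suc e) = refl

K∙-at : ∀ c f n → (K c ∙ f) n ≡ c ℤ.* f n
K∙-at c f n = trans (at (∙≈⊛ (K c) f) n) (at (K-⊛ c f) n)

G-suc-at : ∀ k n → G (suc k) n ≡ (G k ⊞ multiples (suc k) n ∙ G k) n
G-suc-at k n = trans (cong (λ c → + (PDb k n) ℤ.+ c) (sum n)) (sym (⊞-at (G k) (multiples t n ∙ G k) n))
  where
  t : ℕ
  t = suc k
  summand : ℕ → ℕ
  summand m = if (1 ≤ᵇ m) ∧ (m * t ≤ᵇ n) then m * PDb k (n ∸ m * t) else 0
  choose : ∀ b m v → + (if b then m * v else 0) ≡ + m ℤ.* (if b then + v else + 0)
  choose true  m v = ℤ.pos-* m v
  choose false m v = sym (ℤ.*-zeroʳ (+ m))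
  term : ∀ m → + summand m ≡ (K (+ m) ∙ mono (m * t) ∙ G k) n
  term zero    = sym (trans (at (solve 2 (λ a b → con (+ 0) :* a :* b := con (+ 0)) ≈-refl (mono 0) (G k)) n) (K-0 n))
  term (suc m) = trans (choose (suc m * t ≤ᵇ n) (suc m) (PDb k (n ∸ suc m * t)))
    (sym (trans (at (solve 3 (λ a b c → a :* b :* c := a :* (b :* c))
        ≈-refl (K (+ suc m)) (mono (suc m * t)) (G k)) n)
      (trans (K∙-at (+ suc m) (mono (suc m * t) ∙ G k) n) (cong (λ c → + suc m ℤ.* c) (mono-∙-at (suc m * t) (G k) n)))))
  sum : ∀ M → + sumℕ M summand ≡ (multiples t M ∙ G k) n
  sum zero    = term zero
  sum (suc M) = trans (ℤ.pos-+ (sumℕ M summand) (summand (suc M))) (trans (cong₂ ℤ._+_ (sum M) (term (suc M)))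
    (sym (trans (at (solve 3 (λ a b c → (a :+ b) :* c := a :* c :+ b :* c)
        ≈-refl (multiples t M) (K (+ suc M) ∙ mono (suc M * t)) (G k)) n)
      (⊞-at (multiples t M ∙ G k) (K (+ suc M) ∙ mono (suc M * t) ∙ G k) n))))

multiples-stable : ∀ k {N} M → N ≤ M → multiples (suc k) M ≈[ suc N ] multiples (suc k) N
multiples-stable k {N} M N≤M = subst (λ M → multiples (suc k) M ≈[ suc N ] multiples (suc k) N)
    (ℕ.m∸n+n≡m N≤M) (go (M ∸ N))
  where
  go : ∀ d → multiples (suc k) (d + N) ≈[ suc N ] multiples (suc k) N
  go zero    = ≈[]-refl
  go (suc d) = ≈[]-trans
    (⊞-cong[] (go d) (∙-cong[] ≈[]-refl (mono-≈[] {suc (d + N) * suc k} (ℕ.≤-trans (s≤s (ℕ.m≤n+m N d))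
        (ℕ.m≤m*n (suc (d + N)) (suc k))))))
    (≈⇒≈[] (solve 2 (λ a c → a :+ c :* con (+ 0) := a) ≈-refl (multiples (suc k) N) (K (+ suc (d + N)))))

multiples-small : ∀ k M → multiples (suc k) M ≈[ suc k ] K (+ 0)
multiples-small k zero    = ≈⇒≈[] (solve 1 (λ a → con (+ 0) :* a := con (+ 0)) ≈-refl (mono 0))
multiples-small k (suc M) = ≈[]-trans
  (⊞-cong[] (multiples-small k M) (∙-cong[] ≈[]-refl (mono-≈[] {suc M * suc k} (ℕ.m≤m+n (suc k) (M * suc k)))))
  (≈⇒≈[] (solve 1 (λ c → con (+ 0) :+ c :* con (+ 0) := con (+ 0)) ≈-refl (K (+ suc M))))

-- `PDb` bounds the multiplicity by n itself, so each coefficient has its own cutoff. One cutoff M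
-- serves all n ≤ M, since m copies of a positive part weigh at least m.
G-suc : ∀ k M → G (suc k) ≈[ suc M ] G k ⊞ multiples (suc k) M ∙ G k
G-suc k M = mk≈[] λ { {n} (s≤s n≤M) → trans (G-suc-at k n)
  (sym (below (⊞-cong[] (≈[]-refl {f = G k}) (∙-cong[] (multiples-stable k M n≤M) (≈[]-refl {f = G k}))) ℕ.≤-refl)) }

-- Σ_{m ≥ 1} m w^m = w / (1 - w)², truncated at m = M.
multiples-telescoped : ∀ t M → let w = mono t in
  1- w ∙ 1- w ∙ multiples t M ≈ w ⊞ mono (suc M * t) ∙ (⊟ K (+ suc M) ⊞ K (+ M) ∙ w)
multiples-telescoped t zero    = ≈-trans
  (solve 1 (λ w → (con (+ 1) :+ :- w) :* (con (+ 1) :+ :- w) :* (con (+ 0) :* con (+ 1)) :=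
      w :+ w :* (:- con (+ 1) :+ con (+ 0) :* w)) ≈-refl (mono t))
  (⊞-congˡ (∙-congʳ (mono-cong (sym (ℕ.+-identityʳ t)))))
multiples-telescoped t (suc M) = begin
  1- w ∙ 1- w ∙ (multiples t M ⊞ K (+ suc M) ∙ p)
    ≈⟨ solve 4 (λ w s c p → (con (+ 1) :+ :- w) :* (con (+ 1) :+ :- w) :* (s :+ c :* p) :=
         (con (+ 1) :+ :- w) :* (con (+ 1) :+ :- w) :* s :+ (con (+ 1) :+ :- w) :* (con (+ 1) :+ :- w) :* (c :* p))
             ≈-refl w (multiples t M) (K (+ suc M)) p ⟩
  1- w ∙ 1- w ∙ multiples t M ⊞ 1- w ∙ 1- w ∙ (K (+ suc M) ∙ p)
    ≈⟨ ⊞-cong (multiples-telescoped t M) (∙-congˡ (∙-congʳ (K-suc M))) ⟩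
  w ⊞ p ∙ (⊟ K (+ suc M) ⊞ c ∙ w) ⊞ 1- w ∙ 1- w ∙ ((K (+ 1) ⊞ c) ∙ p)
    ≈⟨ ⊞-congʳ (⊞-congˡ (∙-congˡ (⊞-congʳ (⊟-cong (K-suc M))))) ⟩
  w ⊞ p ∙ (⊟ (K (+ 1) ⊞ c) ⊞ c ∙ w) ⊞ 1- w ∙ 1- w ∙ ((K (+ 1) ⊞ c) ∙ p)
    ≈⟨ solve 3 (λ w c p → w :+ p :* (:- (con (+ 1) :+ c) :+ c :* w) :+ (con (+ 1) :+ :- w) :* (con (+ 1) :+ :- w) :* ((con (+ 1) :+ c) :* p) :=
         w :+ w :* p :* (:- (con (+ 1) :+ (con (+ 1) :+ c)) :+ (con (+ 1) :+ c) :* w)) ≈-refl w c p ⟩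
  w ⊞ w ∙ p ∙ (⊟ (K (+ 1) ⊞ (K (+ 1) ⊞ c)) ⊞ (K (+ 1) ⊞ c) ∙ w)
    ≈⟨ ⊞-congˡ (∙-cong (mono-+ t (suc M * t)) (⊞-cong (⊟-cong (≈-trans (K-suc (suc M)) (⊞-congˡ (K-suc M))))
        (∙-congʳ (K-suc M)))) ⟨
  w ⊞ mono (suc (suc M) * t) ∙ (⊟ K (+ suc (suc M)) ⊞ K (+ suc M) ∙ w) ∎
  where
  w p c : PS
  w = mono t
  p = mono (suc M * t)
  c = K (+ M)
  K-suc : ∀ m → K (+ suc m) ≈ K (+ 1) ⊞ K (+ m)
  K-suc m = K-+ (+ 1) (+ m)

-- The factor of the part size k + 1 is 1 + w/(1 - w)², and (1 - w)² + w = 1 - w + w². The tail of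
-- the telescoped sum lies beyond the precision N.
G-step : ∀ k → let w = mono (suc k) in 1- w ∙ 1- w ∙ G (suc k) ≈ (1- w ⊞ w ∙ w) ∙ G k
G-step k = ≈[]⇒≈ λ N → ≈[]-mono (ℕ.n≤1+n N) (≈[]-trans (∙-cong[] ≈[]-refl (G-suc k N)) (≈[]-trans
  (≈⇒≈[] (≈-trans
    (solve 3 (λ w g s → (con (+ 1) :+ :- w) :* (con (+ 1) :+ :- w) :* (g :+ s :* g) :=
        ((con (+ 1) :+ :- w) :* (con (+ 1) :+ :- w) :+ (con (+ 1) :+ :- w) :* (con (+ 1) :+ :- w) :* s) :* g)
      ≈-refl w (G k) (multiples (suc k) N))
    (∙-congʳ (⊞-congˡ (multiples-telescoped (suc k) N)))))
  (≈[]-trans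
    (∙-cong[] (⊞-cong[] ≈[]-refl (⊞-cong[] ≈[]-refl (∙-cong[] (mono-≈[] {suc N * suc k}
        (ℕ.m≤m*n (suc N) (suc k))) ≈[]-refl))) (≈[]-refl {f = G k}))
    (≈⇒≈[] (solve 3 (λ w g e → ((con (+ 1) :+ :- w) :* (con (+ 1) :+ :- w) :+ (w :+ con (+ 0) :* e)) :* g :=
        (con (+ 1) :+ :- w :+ w :* w) :* g)
      ≈-refl w (G k) (⊟ K (+ suc N) ⊞ K (+ N) ∙ w))))))
  where
  w : PS
  w = mono (suc k)

PDs : PS
PDs n = + PD n

-- Allowing the part size k + 1 changes no coefficient below k + 1, so the coefficient of q^n is
-- constant in k from k = n on.
G-⟶ : G ⟶ PDs
G-⟶ = mk⟶ λ N → mk≈[] λ {n} n<N → trans (cong (λ k → G k n) (sym (ℕ.m∸n+n≡m (ℕ.<⇒≤ n<N)))) (stable n (N ∸ n))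
  where
  small : ∀ k → G (suc k) ≈[ suc k ] G k
  small k = ≈[]-trans (G-suc k k) (≈[]-trans (⊞-cong[] (≈[]-refl {f = G k})
      (∙-cong[] (multiples-small k k) (≈[]-refl {f = G k})))
    (≈⇒≈[] (solve 1 (λ g → g :+ con (+ 0) :* g := g) ≈-refl (G k))))
  stable : ∀ n d → G (d + n) n ≡ G n n
  stable n zero    = refl
  stable n (suc d) = trans (below (small (d + n)) (s≤s (ℕ.m≤n+m n d))) (stable n d)

PD-generating-function : PDs ∙ (Π⁻ 1 1 ∙ Π⁻ 2 2 ∙ Π⁻ 3 3) ≈ Π⁻ 6 6
PD-generating-function = ⟶-unique
  (⟶-cong finite (⟶-∙ G-⟶ (⟶-∙ (⟶-∙ (poch±-⟶ _ 0 0) (poch±-⟶ _ 1 1)) (poch±-⟶ _ 2 2))))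
  (poch±-⟶ _ 5 5)
  where
  F : ℕ → ℕ → PS
  F i j = fac -1ℤ (i + i * j)
  mono-multiple : ∀ i k → mono (i * k) ≈ mono k ^^ i
  mono-multiple zero    k = ≈-refl
  mono-multiple (suc i) k = ≈-trans (mono-+ k (i * k)) (∙-congˡ (mono-multiple i k))
  F≈ : ∀ i j → F i j ≈ 1- (mono (suc j) ^^ i)
  F≈ i j = ≈-trans (fac-neg (i + i * j)) (⊞-congˡ (⊟-cong (≈-trans (mono-cong (sym
      (ℕ.*-suc i j))) (mono-multiple i (suc j)))))
  step : ∀ j → G (suc j) ∙ (F 1 j ∙ F 2 j ∙ F 3 j) ≈ G j ∙ F 6 j
  step j = begin
    G (suc j) ∙ (F 1 j ∙ F 2 j ∙ F 3 j)
      ≈⟨ ∙-congˡ (∙-cong (∙-cong (F≈ 1 j) (F≈ 2 j)) (F≈ 3 j)) ⟩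
    G (suc j) ∙ (1- (w ^^ 1) ∙ 1- (w ^^ 2) ∙ 1- (w ^^ 3))
      -- The factor 1 - w² is split as (1 - w)(1 + w) to expose the square (1 - w)² that `G-step`
      -- consumes.
      ≈⟨ solve 2 (λ w g → g :* ((con (+ 1) :+ :- (w :* con (+ 1))) :* (con (+ 1) :+ :- (w :* (w :* con (+ 1)))) :* (con (+ 1) :+ :- (w :* (w :* (w :* con (+ 1)))))) :=
           (con (+ 1) :+ :- w) :* (con (+ 1) :+ :- w) :* g :* ((con (+ 1) :+ w) :* (con (+ 1) :+ :- (w :* (w :* w))))) ≈-refl w (G (suc j)) ⟩
    1- w ∙ 1- w ∙ G (suc j) ∙ (1+ w ∙ 1- (w ∙ (w ∙ w)))
      ≈⟨ ∙-congʳ (G-step j) ⟩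
    (1- w ⊞ w ∙ w) ∙ G j ∙ (1+ w ∙ 1- (w ∙ (w ∙ w)))
      -- (1 - w + w²)(1 + w) = 1 + w³, which meets 1 - w³.
      ≈⟨ solve 2 (λ w g → (con (+ 1) :+ :- w :+ w :* w) :* g :* ((con (+ 1) :+ w) :* (con (+ 1) :+ :- (w :* (w :* w)))) :=
           g :* (con (+ 1) :+ :- (w :* (w :* (w :* (w :* (w :* (w :* con (+ 1))))))))) ≈-refl w (G j) ⟩
    G j ∙ 1- (w ^^ 6)
      ≈⟨ ∙-congˡ (F≈ 6 j) ⟨
    G j ∙ F 6 j ∎
    where
    w : PS
    w = mono (suc j)
  finite : ∀ N → G N ∙ (∏ N (F 1) ∙ ∏ N (F 2) ∙ ∏ N (F 3)) ≈ ∏ N (F 6)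
  finite zero    = ≈-trans (∙-congʳ G-0) (solve 0 (con (+ 1) :* (con (+ 1) :* con (+ 1) :* con (+ 1)) :=
      con (+ 1)) ≈-refl)
    where
    G-0 : G 0 ≈ K (+ 1)
    G-0 = mk≈ λ { zero → refl ; (suc n) → refl }
  finite (suc N) = begin
    G (suc N) ∙ (∏ N (F 1) ∙ F 1 N ∙ (∏ N (F 2) ∙ F 2 N) ∙ (∏ N (F 3) ∙ F 3 N))
      ≈⟨ solve 7 (λ g a b c x y z → g :* (a :* x :* (b :* y) :* (c :* z)) :=
          g :* (x :* y :* z) :* (a :* b :* c)) ≈-refl
           (G (suc N)) (∏ N (F 1)) (∏ N (F 2)) (∏ N (F 3)) (F 1 N) (F 2 N) (F 3 N) ⟩
    G (suc N) ∙ (F 1 N ∙ F 2 N ∙ F 3 N) ∙ (∏ N (F 1) ∙ ∏ N (F 2) ∙ ∏ N (F 3))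
      ≈⟨ ∙-congʳ (step N) ⟩
    G N ∙ F 6 N ∙ (∏ N (F 1) ∙ ∏ N (F 2) ∙ ∏ N (F 3))
      ≈⟨ solve 3 (λ g f p → g :* f :* p := g :* p :* f) ≈-refl (G N) (F 6 N) (∏ N (F 1) ∙ ∏ N (F 2) ∙ ∏ N (F 3)) ⟩
    G N ∙ (∏ N (F 1) ∙ ∏ N (F 2) ∙ ∏ N (F 3)) ∙ F 6 N
      ≈⟨ ∙-congʳ (finite N) ⟩
    ∏ N (F 6) ∙ F 6 N ∎

-- The section PD(3n + 1)

▷-supported : ∀ {f g a b c a′} → f ▷⟨ a , b , c ⟩ → g ▷⟨ a′ , K (+ 0) , K (+ 0) ⟩ →
    (f ∙ g) ▷⟨ a ∙ a′ , b ∙ a′ , c ∙ a′ ⟩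
▷-supported {a = a} {b} {c} {a′} f▷ g▷ = ▷-resp ≈-refl
  (solve 5 (λ q a b c a′ → a :* a′ :+ q :* (b :* con (+ 0) :+ c :* con (+ 0)) := a :* a′) ≈-refl q a b c a′)
  (solve 5 (λ q a b c a′ → a :* con (+ 0) :+ b :* a′ :+ q :* (c :* con (+ 0)) := b :* a′) ≈-refl q a b c a′)
  (solve 4 (λ a b c a′ → a :* con (+ 0) :+ b :* con (+ 0) :+ c :* a′ := c :* a′) ≈-refl a b c a′)
  (▷-∙ f▷ g▷)

▷-euler : ∀ k → let κ = suc k in Π⁻ (κ * 3) (κ * 3) ▷⟨ Π⁻ κ κ , K (+ 0) , K (+ 0) ⟩
▷-euler k = ▷-⟶ (poch±-⟶ _ (2 + k * 3) (2 + k * 3)) (_* 3) (λ _ → ℕ.≤-refl) (λ N → finite (N * 3))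
  (⟶-subsequence (_* 3) (λ N → ℕ.m≤m*n N 3) (poch±-⟶ _ k k)) const-⟶ const-⟶
  where
  κ : ℕ
  κ = suc k
  σ : ℤ
  σ = ℤ.- + 1
  exponent : ∀ κ j → (κ + κ * j) * 3 ≡ κ * 3 + κ * 3 * j
  exponent = solve-∀
  factor : ∀ j → fac σ (κ * 3 + κ * 3 * j) ▷⟨ fac σ (κ + κ * j) , K (+ 0) , K (+ 0) ⟩
  factor j = ▷-resp (fac-cong σ (exponent κ j)) ≈-refl
    (solve 0 (con (+ 0) :+ con σ :* con (+ 0) := con (+ 0)) ≈-refl)
    (solve 0 (con (+ 0) :+ con σ :* con (+ 0) := con (+ 0)) ≈-refl)
    (▷-⊞ (▷-K (+ 1)) (▷-K∙ σ (▷-mono₀ (κ + κ * j))))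
  finite : ∀ n → ∏ n (λ j → fac σ (κ * 3 + κ * 3 * j)) ▷⟨ ∏ n (λ j → fac σ (κ + κ * j)) , K (+ 0) , K (+ 0) ⟩
  finite zero    = ▷-K (+ 1)
  finite (suc n) = ▷-resp ≈-refl ≈-refl
    (solve 1 (λ x → con (+ 0) :* x := con (+ 0)) ≈-refl (fac σ (κ + κ * n)))
    (solve 1 (λ x → con (+ 0) :* x := con (+ 0)) ≈-refl (fac σ (κ + κ * n)))
    (▷-supported (finite n) (factor n))

-- The three sections of P F f₃ = f₆ are a 3 × 3 linear system for those of P.
cramer : ∀ {P F f₃ f₆ a b c f₁ f₂} →
  F ▷⟨ a , b , c ⟩ → f₃ ▷⟨ f₁ , K (+ 0) , K (+ 0) ⟩ → f₆ ▷⟨ f₂ , K (+ 0) , K (+ 0) ⟩ →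
  P ∙ (F ∙ f₃) ≈ f₆ → sect 1 P ∙ f₁ ∙ norm a b c ≈ f₂ ∙ (q ∙ (c ∙ c) ⊞ ⊟ (a ∙ b))
cramer {P} {F} {f₃} {f₆} {a} {b} {c} {f₁} {f₂} F▷ f₃▷ f₆▷ PFf₃≈f₆ = begin
  p₁ ∙ f₁ ∙ norm a b c
    ≈⟨ solve 8 (λ q a b c f p₀ p₁ p₂ →
         p₁ :* f :* (a :* a :* a :+ q :* (b :* b :* b) :+ q :* q :* (c :* c :* c) :+ :- (con (+ 3) :* q :* a :* b :* c)) :=
         (p₀ :* (a :* f) :+ q :* (p₁ :* (c :* f) :+ p₂ :* (b :* f))) :* (q :* (c :* c) :+ :- (a :* b))
         :+ (p₀ :* (b :* f) :+ p₁ :* (a :* f) :+ q :* (p₂ :* (c :* f))) :* (a :* a :+ :- (q :* b :* c))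
         :+ (p₀ :* (c :* f) :+ p₁ :* (b :* f) :+ p₂ :* (a :* f)) :* (q :* (b :* b :+ :- (a :* c))))
             ≈-refl q a b c f₁ p₀ p₁ p₂ ⟩
  product₀ p₀ p₁ p₂ (a ∙ f₁) (b ∙ f₁) (c ∙ f₁) ∙ r₀ ⊞ product₁ p₀ p₁ p₂ (a ∙ f₁) (b ∙ f₁) (c ∙ f₁) ∙ r₁
    ⊞ product₂ p₀ p₁ p₂ (a ∙ f₁) (b ∙ f₁) (c ∙ f₁) ∙ r₂
    ≈⟨ ⊞-cong (⊞-cong (∙-congʳ (proj₁ system)) (∙-congʳ (proj₁ (proj₂ system)))) (∙-congʳ (proj₂ (proj₂ system))) ⟩
  f₂ ∙ r₀ ⊞ K (+ 0) ∙ r₁ ⊞ K (+ 0) ∙ r₂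
    ≈⟨ solve 4 (λ f r s t → f :* r :+ con (+ 0) :* s :+ con (+ 0) :* t := f :* r) ≈-refl f₂ r₀ r₁ r₂ ⟩
  f₂ ∙ r₀ ∎
  where
  p₀ p₁ p₂ r₀ r₁ r₂ : PS
  p₀ = sect 0 P
  p₁ = sect 1 P
  p₂ = sect 2 P
  -- The cofactors of the column of p₁ in the matrix of multiplication by F. The right side of the
  -- system is (f₂, 0, 0), so only `r₀` survives.
  r₀ = q ∙ (c ∙ c) ⊞ ⊟ (a ∙ b)
  r₁ = a ∙ a ⊞ ⊟ (q ∙ b ∙ c)
  r₂ = q ∙ (b ∙ b ⊞ ⊟ (a ∙ c))
  system : (product₀ p₀ p₁ p₂ (a ∙ f₁) (b ∙ f₁) (c ∙ f₁) ≈ f₂)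
         × (product₁ p₀ p₁ p₂ (a ∙ f₁) (b ∙ f₁) (c ∙ f₁) ≈ K (+ 0))
         × (product₂ p₀ p₁ p₂ (a ∙ f₁) (b ∙ f₁) (c ∙ f₁) ≈ K (+ 0))
  system = ▷-unique (▷-∙ {f = P} (mk▷ ≈-refl ≈-refl ≈-refl) (▷-supported F▷ f₃▷)) (▷-resp (≈-sym PFf₃≈f₆)
      ≈-refl ≈-refl ≈-refl f₆▷)

module PDSection where

  x y g₂ g₆ f₁ f₃ A B C D Φ Ψ : PS
  x = Π⁻ 1 2
  y = Π⁻ 3 6
  g₂ = Π⁻ 2 2
  g₆ = Π⁻ 6 6
  f₁ = Π⁻ 1 1
  f₃ = Π⁻ 3 3
  A = g₆ ∙ (y ∙ y)
  B = g₆ ∙ (Π⁻ 5 6 ∙ Π⁻ 1 6)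
  C = f₃ ∙ (Π⁺ 1 3 ∙ Π⁺ 2 3)
  D = Π⁻ 12 12 ∙ (Π⁺ 3 12 ∙ Π⁺ 9 12)
  -- φ(-q) and ψ(q).
  Φ = g₂ ∙ (x ∙ x)
  Ψ = Π⁻ 4 4 ∙ (Π⁺ 1 4 ∙ Π⁺ 3 4)

  -2ℤ : ℤ
  -2ℤ = ℤ.- + 2

  ΦΨ≈f₁f₂ : Φ ∙ Ψ ≈ f₁ ∙ g₂
  ΦΨ≈f₁f₂ = ≈-trans (solve 3 (λ g x ψ → g :* (x :* x) :* ψ := x :* g :* (ψ :* x)) ≈-refl g₂ x Ψ)
    (∙-cong (≈-sym f₁≈) ψ-product)

  a₀ b₀ c₀ : PS
  a₀ = A ∙ C
  b₀ = A ∙ D ⊞ K -2ℤ ∙ B ∙ C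
  c₀ = K -2ℤ ∙ B ∙ D

  ΦΨ-trisection : (Φ ∙ Ψ) ▷⟨ a₀ , b₀ , c₀ ⟩
  ΦΨ-trisection = ▷-resp ≈-refl
    (solve 5 (λ q A B C D → A :* C :+ q :* (con -2ℤ :* B :* con (+ 0) :+ con (+ 0) :* D) := A :* C) ≈-refl q A B C D)
    (solve 5 (λ q A B C D → A :* D :+ con -2ℤ :* B :* C :+ q :* (con (+ 0) :* con (+ 0)) :=
        A :* D :+ con -2ℤ :* B :* C) ≈-refl q A B C D)
    (solve 4 (λ A B C D → A :* con (+ 0) :+ con -2ℤ :* B :* D :+ con (+ 0) :* C := con -2ℤ :* B :* D) ≈-refl A B C D)
    (▷-∙ φ-trisection ψ-trisection)

  Norm-ΦΨ : norm a₀ b₀ c₀ ≈ Norm f₁ ∙ Norm g₂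
  Norm-ΦΨ = ≈-trans (≈-sym (Norm-▷ ΦΨ-trisection)) (≈-trans (Norm-cong ΦΨ≈f₁f₂) (Norm-∙ f₁ g₂))

  PD-section : sect 1 PDs ∙ f₁ ∙ norm a₀ b₀ c₀ ≈ g₂ ∙ (q ∙ (c₀ ∙ c₀) ⊞ ⊟ (a₀ ∙ b₀))
  PD-section = cramer ΦΨ-trisection (▷-euler 0) (▷-euler 1)
    (≈-trans (∙-congˡ (∙-congʳ ΦΨ≈f₁f₂)) PD-generating-function)

  p₁ E : PS
  p₁ = sect 1 PDs
  E = q ∙ (c₀ ∙ c₀) ⊞ ⊟ (a₀ ∙ b₀)

  -- The exponents: the norms multiplied by f₃ g₆ become f₁⁴ g₂⁴, and with the f₁ beside p₁ this is
  -- f₁⁵ g₂⁴ = x⁵ g₂⁹. One g₂ cancels against the right side, and f₃ g₆ = y g₆².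
  cleared : p₁ ∙ (x ^^ 5 ∙ g₂ ^^ 8) ≈ y ∙ (g₆ ∙ g₆) ∙ E
  cleared = ∙-cancelˡ (poch±-constant _ 1 2) (begin
    g₂ ∙ (p₁ ∙ (x ^^ 5 ∙ g₂ ^^ 8))
      ≈⟨ solve 3 (λ p x g → g :* (p :* ((x :* (x :* (x :* (x :* (x :* con (+ 1)))))) :* (g :* (g :* (g :* (g :* (g :* (g :* (g :* (g :* con (+ 1)))))))))))
           := p :* (x :* g) :* (x :* g :* (x :* g :* (x :* g) :* (x :* g))) :* (g :* (g :* g :* g))) ≈-refl p₁ x g₂ ⟩
    p₁ ∙ (x ∙ g₂) ∙ (x ∙ g₂ ∙ (x ∙ g₂ ∙ (x ∙ g₂) ∙ (x ∙ g₂))) ∙ (g₂ ∙ (g₂ ∙ g₂ ∙ g₂))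
      ≈⟨ ∙-congʳ (∙-cong (∙-congˡ f₁≈) (∙-cong f₁≈ (∙-cong (∙-cong f₁≈ f₁≈) f₁≈))) ⟨
    p₁ ∙ f₁ ∙ (f₁ ∙ (f₁ ∙ f₁ ∙ f₁)) ∙ (g₂ ∙ (g₂ ∙ g₂ ∙ g₂))
      ≈⟨ ∙-cong (∙-congˡ Norm-f₁) Norm-f₂ ⟨
    p₁ ∙ f₁ ∙ (Norm f₁ ∙ f₃) ∙ (Norm g₂ ∙ g₆)
      ≈⟨ solve 6 (λ p f m n u v → p :* f :* (m :* u) :* (n :* v) := p :* f :* (m :* n) :* (u :* v))
          ≈-refl p₁ f₁ (Norm f₁) (Norm g₂) f₃ g₆ ⟩
    p₁ ∙ f₁ ∙ (Norm f₁ ∙ Norm g₂) ∙ (f₃ ∙ g₆)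
      ≈⟨ ∙-cong (≈-trans (∙-congˡ (≈-sym Norm-ΦΨ)) PD-section) (∙-congʳ f₃≈) ⟩
    g₂ ∙ E ∙ (y ∙ g₆ ∙ g₆)
      ≈⟨ solve 4 (λ g e y h → g :* e :* (y :* h :* h) := g :* (y :* (h :* h) :* e)) ≈-refl g₂ E y g₆ ⟩
    g₂ ∙ (y ∙ (g₆ ∙ g₆) ∙ E) ∎)

  -- Each of the two factors B and each of the two factors D needs one y to become a product of x
  -- and g₆; 4 = (-2)².
  c-term : q ∙ (c₀ ∙ c₀) ∙ (y ∙ y ∙ (y ∙ y)) ≈ K (+ 4) ∙ q ∙ (x ∙ g₆ ∙ (x ∙ g₆) ∙ (g₆ ∙ g₆))
  c-term = begin
    q ∙ (c₀ ∙ c₀) ∙ (y ∙ y ∙ (y ∙ y))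
      ≈⟨ solve 4 (λ q B D y → q :* (con -2ℤ :* B :* D :* (con -2ℤ :* B :* D)) :* (y :* y :* (y :* y)) :=
           con (+ 4) :* q :* (B :* y :* (B :* y) :* (D :* y :* (D :* y)))) ≈-refl q B D y ⟩
    K (+ 4) ∙ q ∙ (B ∙ y ∙ (B ∙ y) ∙ (D ∙ y ∙ (D ∙ y)))
      ≈⟨ ∙-congˡ (∙-cong (∙-cong φ-part₁ φ-part₁) (∙-cong ψ-part₁ ψ-part₁)) ⟩
    K (+ 4) ∙ q ∙ (x ∙ g₆ ∙ (x ∙ g₆) ∙ (g₆ ∙ g₆)) ∎

  -- After clearing denominators both summands of `b₀` are multiples of x y² g₆², with coefficients
  -- 1 and -2, so their sum is a single product with coefficient -1.
  ab-term : a₀ ∙ b₀ ∙ (x ∙ x ∙ y) ≈ ⊟ (x ∙ (y ∙ y ∙ (y ∙ y) ∙ (y ∙ y)) ∙ (g₆ ∙ g₆ ∙ (g₆ ∙ g₆)))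
  ab-term = begin
    a₀ ∙ b₀ ∙ (x ∙ x ∙ y)
      ≈⟨ solve 6 (λ A B C D x y → A :* C :* (A :* D :+ con -2ℤ :* B :* C) :* (x :* x :* y) :=
           A :* (C :* x) :* (A :* x :* (D :* y) :+ con -2ℤ :* (B :* y) :* (C :* x))) ≈-refl A B C D x y ⟩
    A ∙ (C ∙ x) ∙ (A ∙ x ∙ (D ∙ y) ⊞ K -2ℤ ∙ (B ∙ y) ∙ (C ∙ x))
      ≈⟨ ∙-cong (∙-congˡ ψ-part₀) (⊞-cong (∙-congˡ ψ-part₁) (∙-cong (∙-congˡ φ-part₁) ψ-part₀)) ⟩
    A ∙ (y ∙ y ∙ g₆) ∙ (A ∙ x ∙ g₆ ⊞ K -2ℤ ∙ (x ∙ g₆) ∙ (y ∙ y ∙ g₆))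
      ≈⟨ solve 3 (λ x y g → g :* (y :* y) :* (y :* y :* g) :* (g :* (y :* y) :* x :* g :+ con -2ℤ :* (x :* g) :* (y :* y :* g)) :=
           :- (x :* (y :* y :* (y :* y) :* (y :* y)) :* (g :* g :* (g :* g)))) ≈-refl x y g₆ ⟩
    ⊟ (x ∙ (y ∙ y ∙ (y ∙ y) ∙ (y ∙ y)) ∙ (g₆ ∙ g₆ ∙ (g₆ ∙ g₆))) ∎

  -- The factor x y⁶ is the common denominator of the bracket in the theorem. `ab-term` requires x²,
  -- so the proof multiplies by one more x and cancels it.
  E-cleared : y ∙ (g₆ ∙ g₆) ∙ E ∙ (x ∙ y ^^ 6) ≈ y ^^ 3 ∙ g₆ ^^ 6 ∙ (K (+ 4) ∙ (q ∙ (x ^^ 2 ∙ x)) ⊞ y ^^ 3 ∙ y ^^ 6)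
  E-cleared = ∙-cancelˡ (poch±-constant _ 0 2) (begin
    x ∙ (y ∙ (g₆ ∙ g₆) ∙ E ∙ (x ∙ y ^^ 6))
      ≈⟨ solve 5 (λ x y g u v → x :* (y :* (g :* g) :* (u :+ :- v) :* (x :* :pow y 6)) :=
           y :* (g :* g) :* (u :* (y :* y :* (y :* y)) :* (x :* x :* (y :* y)) :+ :- (v :* (x :* x :* y) :* :pow y 5)))
           ≈-refl x y g₆ (q ∙ (c₀ ∙ c₀)) (a₀ ∙ b₀) ⟩
    y ∙ (g₆ ∙ g₆) ∙ (q ∙ (c₀ ∙ c₀) ∙ (y ∙ y ∙ (y ∙ y)) ∙ (x ∙ x ∙ (y ∙ y)) ⊞ ⊟ (a₀ ∙ b₀ ∙ (x ∙ x ∙ y) ∙ y ^^ 5))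
      ≈⟨ ∙-congˡ (⊞-cong (∙-congʳ c-term) (⊟-cong (∙-congʳ ab-term))) ⟩
    y ∙ (g₆ ∙ g₆) ∙ (K (+ 4) ∙ q ∙ (x ∙ g₆ ∙ (x ∙ g₆) ∙ (g₆ ∙ g₆)) ∙ (x ∙ x ∙ (y ∙ y))
      ⊞ ⊟ (⊟ (x ∙ (y ∙ y ∙ (y ∙ y) ∙ (y ∙ y)) ∙ (g₆ ∙ g₆ ∙ (g₆ ∙ g₆))) ∙ y ^^ 5))
      ≈⟨ solve 4 (λ q x y g → y :* (g :* g) :* (con (+ 4) :* q :* (x :* g :* (x :* g) :* (g :* g)) :* (x :* x :* (y :* y))
             :+ :- (:- (x :* (y :* y :* (y :* y) :* (y :* y)) :* (g :* g :* (g :* g))) :* :pow y 5)) :=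
           x :* (:pow y 3 :* :pow g 6 :* (con (+ 4) :* (q :* (:pow x 2 :* x)) :+ :pow y 3 :* :pow y 6)))
               ≈-refl q x y g₆ ⟩
    x ∙ (y ^^ 3 ∙ g₆ ^^ 6 ∙ (K (+ 4) ∙ (q ∙ (x ^^ 2 ∙ x)) ⊞ y ^^ 3 ∙ y ^^ 6)) ∎)
    where
    :pow : ∀ {n} → Polynomial n → ℕ → Polynomial n
    :pow p zero    = con (+ 1)
    :pow p (suc k) = p :* :pow p k

  -- The inverses enter only through their defining equations, so those of the theorem can be
  -- inserted as they stand, without transporting `invPS` along `_≈_`.
  section-value : ∀ {iD iy ix} → x ^^ 5 ∙ g₂ ^^ 8 ∙ iD ≈ K (+ 1) → y ^^ 6 ∙ iy ≈ K (+ 1) → x ∙ ix ≈ K (+ 1) →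
    p₁ ≈ y ^^ 3 ∙ g₆ ^^ 6 ∙ iD ∙ (K (+ 4) ∙ (q ∙ (x ^^ 2 ∙ iy)) ⊞ y ^^ 3 ∙ ix)
  section-value {iD} {iy} {ix} DiD≈1 yiy≈1 xix≈1 = begin
    p₁
      ≈⟨ solve 1 (λ p → p := p :* con (+ 1) :* con (+ 1) :* con (+ 1)) ≈-refl p₁ ⟩
    p₁ ∙ K (+ 1) ∙ K (+ 1) ∙ K (+ 1)
      ≈⟨ ∙-cong (∙-cong (∙-congˡ DiD≈1) xix≈1) yiy≈1 ⟨
    p₁ ∙ (D₀ ∙ iD) ∙ (x ∙ ix) ∙ (y⁶ ∙ iy)
      ≈⟨ solve 7 (λ p d id x ix y iy → p :* (d :* id) :* (x :* ix) :* (y :* iy) :=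
          p :* d :* (x :* y) :* (id :* (ix :* iy))) ≈-refl p₁ D₀ iD x ix y⁶ iy ⟩
    p₁ ∙ D₀ ∙ (x ∙ y⁶) ∙ (iD ∙ (ix ∙ iy))
      ≈⟨ ∙-congʳ (≈-trans (∙-congʳ cleared) E-cleared) ⟩
    M ∙ (K (+ 4) ∙ (q ∙ (x ^^ 2 ∙ x)) ⊞ y ^^ 3 ∙ y⁶) ∙ (iD ∙ (ix ∙ iy))
      ≈⟨ solve 9 (λ m q x² x y³ y⁶ id ix iy → m :* (con (+ 4) :* (q :* (x² :* x)) :+ y³ :* y⁶) :* (id :* (ix :* iy)) :=
           m :* id :* (con (+ 4) :* (q :* (x² :* iy :* (x :* ix))) :+ y³ :* ix :* (y⁶ :* iy)))
               ≈-refl M q (x ^^ 2) x (y ^^ 3) y⁶ iD ix iy ⟩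
    M ∙ iD ∙ (K (+ 4) ∙ (q ∙ (x ^^ 2 ∙ iy ∙ (x ∙ ix))) ⊞ y ^^ 3 ∙ ix ∙ (y⁶ ∙ iy))
      ≈⟨ ∙-congˡ (⊞-cong (∙-congˡ (∙-congˡ (∙-congˡ xix≈1))) (∙-congˡ yiy≈1)) ⟩
    M ∙ iD ∙ (K (+ 4) ∙ (q ∙ (x ^^ 2 ∙ iy ∙ K (+ 1))) ⊞ y ^^ 3 ∙ ix ∙ K (+ 1))
      ≈⟨ solve 5 (λ m q u v w → m :* (con (+ 4) :* (q :* (u :* v :* con (+ 1))) :+ w :* con (+ 1)) :=
          m :* (con (+ 4) :* (q :* (u :* v)) :+ w)) ≈-refl
           (M ∙ iD) q (x ^^ 2) iy (y ^^ 3 ∙ ix) ⟩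
    M ∙ iD ∙ (K (+ 4) ∙ (q ∙ (x ^^ 2 ∙ iy)) ⊞ y ^^ 3 ∙ ix) ∎
    where
    D₀ M y⁶ : PS
    D₀ = x ^^ 5 ∙ g₂ ^^ 8
    M = y ^^ 3 ∙ g₆ ^^ 6
    y⁶ = y ^^ 6

-- Transfer to the operations of the statement

⊛≈∙ : ∀ {f f′ g g′} → f ≈ f′ → g ≈ g′ → f ⊛ g ≈ f′ ∙ g′
⊛≈∙ {f} {g = g} f≈ g≈ = ≈-trans (≈-sym (∙≈⊛ f g)) (∙-cong f≈ g≈)

^PS≈^^ : ∀ {f f′} n → f ≈ f′ → f ^PS n ≈ f′ ^^ n
^PS≈^^ zero    f≈ = ≈-sym K-1
^PS≈^^ (suc n) f≈ = ⊛≈∙ f≈ (^PS≈^^ n f≈)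

⊕≈⊞ : ∀ {f f′ g g′} → f ≈ f′ → g ≈ g′ → f ⊕ g ≈ f′ ⊞ g′
⊕≈⊞ {f} {g = g} f≈ g≈ = ≈-trans (mk≈ λ n → sym (⊞-at f g n)) (⊞-cong f≈ g≈)

·≈∙ : ∀ c {f f′} → f ≈ f′ → c · f ≈ K c ∙ f′
·≈∙ c {f} f≈ = ≈-trans (mk≈ λ n → sym (K∙-at c f n)) (∙-congˡ f≈)

qShift≈q∙ : ∀ {f f′} → f ≈ f′ → qShift f ≈ q ∙ f′
qShift≈q∙ {f} f≈ = ≈-trans (≈-sym (q-∙ f)) (∙-congˡ f≈)

open PDSection using (x; y; g₂; section-value)

theorem1p6 : (n : ℕ) →
    + PD (3 * n + 1)
      ≡ ((poch 3 6 ^PS 3) ⊛ (poch 6 6 ^PS 6)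
           ⊛ invPS ((poch 1 2 ^PS 5) ⊛ (poch 2 2 ^PS 8))
           ⊛ ((+ 4) · qShift ((poch 1 2 ^PS 2) ⊛ invPS (poch 3 6 ^PS 6))
              ⊕ (poch 3 6 ^PS 3) ⊛ invPS (poch 1 2)))
        n
theorem1p6 n = trans (cong (λ m → PDs (m + 1)) (ℕ.*-comm 3 n)) (trans (sym (sect-at 1 PDs n)) (at (≈-trans
  (section-value
    -- Here and in the next two lines `refl` evaluates the constant term of the denominator to 1,
    -- the condition for `invPS` to be its inverse.
    (≈-trans (∙-congʳ (≈-sym D≈)) (∙-invPS ((poch 1 2 ^PS 5) ⊛ (poch 2 2 ^PS 8)) refl))
    (≈-trans (∙-congʳ (≈-sym (^PS≈^^ 6 y≈))) (∙-invPS (poch 3 6 ^PS 6) refl))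
    (≈-trans (∙-congʳ (≈-sym x≈)) (∙-invPS (poch 1 2) refl)))
  (≈-sym (⊛≈∙ (⊛≈∙ (⊛≈∙ (^PS≈^^ 3 y≈) (^PS≈^^ 6 (poch-poch± 6 6))) ≈-refl)
    (⊕≈⊞ (·≈∙ (+ 4) (qShift≈q∙ (⊛≈∙ (^PS≈^^ 2 x≈) ≈-refl))) (⊛≈∙ (^PS≈^^ 3 y≈) ≈-refl))))) n))
  where
  x≈ : poch 1 2 ≈ x
  x≈ = poch-poch± 1 2
  y≈ : poch 3 6 ≈ y
  y≈ = poch-poch± 3 6
  D≈ : (poch 1 2 ^PS 5) ⊛ (poch 2 2 ^PS 8) ≈ x ^^ 5 ∙ g₂ ^^ 8
  D≈ = ⊛≈∙ (^PS≈^^ 5 x≈) (^PS≈^^ 8 (poch-poch± 2 2))
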